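{- Let $\alpha \in [1/3, 2/5)$ be directed triangle sufficient and let $\varepsilon > 0$. Then there exists $k_0$ such that for all integers $k \ge k_0$, \[ r_k(\mathcal{L}) < \frac{1+\varepsilon}{1-\alpha}\, k. \]
   Context: A constant $\alpha \in [1/3, 2/5)$ is called directed triangle sufficient if every oriented graph $D$ (a digraph with no loops and at most one arc between any two vertices) with minimum in-degree at least $\alpha |V(D)|$ contains a directed cycle of length 3. The loose path $\mathcal{L}$ is the 3-uniform hypergraph $\{abc, cde, efg\}$ on seven distinct vertices. For a 3-uniform hypergraph $\mathcal{H}$, $r_k(\mathcal{H})$ is the smallest integer $n$ such that every coloring of $\binom{[n]}{3}$ with $k$ colors contains a monochromatic copy of $\mathcal{H}$.
   Formalization: The constants α and ε are taken to be rational numbers instead of real numbers; the real case follows by choosing a rational α' slightly above α (still directed triangle sufficient) and a suitable smaller rational ε'. -}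

module Defs where

open import Data.Nat using (ℕ; zero; suc; _<_)
open import Data.Bool using (Bool; true; false; if_then_else_)
open import Data.Fin using (Fin; #_)
open import Data.List using (List; map; allFin)
open import Data.Nat.ListAction using (sum)
open import Data.Integer using (+_)
open import Data.Rational using (ℚ; _/_; 1ℚ; _-_; _*_) renaming (_≤_ to _≤ℚ_; _<_ to _<ℚ_)
open import Data.Product using (Σ; _×_; ∃-syntax)
open import Relation.Binary.PropositionalEquality using (_≡_; _≢_)
open import Relation.Nullary using (¬_)
open import Function.Definitions using (Injective)

⟦_⟧ : ℕ → ℚ
⟦ n ⟧ = + n / 1

-- A digraph on vertex set Fin n, given by its arc indicator: A u v ≡ true iff u → v is an arc.
Digraph : ℕ → Set
Digraph n = Fin n → Fin n → Bool

IsOriented : ∀ {n} → Digraph n → Set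
IsOriented {n} A =
  ((v : Fin n) → A v v ≡ false) ×
  ((u v : Fin n) → A u v ≡ true → A v u ≡ false)

inDegree : ∀ {n} → Digraph n → Fin n → ℕ
inDegree {n} A v = sum (map (λ u → if A u v then 1 else 0) (allFin n))

MinInDegreeAtLeast : ∀ {n} → Digraph n → ℚ → Set
MinInDegreeAtLeast {n} A α = (v : Fin n) → α * ⟦ n ⟧ ≤ℚ ⟦ inDegree A v ⟧

-- contains a directed cycle of length 3 (distinctness is automatic in an oriented graph)
HasDirectedTriangle : ∀ {n} → Digraph n → Set
HasDirectedTriangle {n} A =
  ∃[ a ] ∃[ b ] ∃[ c ] (A a b ≡ true × A b c ≡ true × A c a ≡ true)

DirectedTriangleSufficient : ℚ → Set
DirectedTriangleSufficient α =
  (+ 1 / 3 ≤ℚ α) × (α <ℚ + 2 / 5) ×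
  ((n : ℕ) → 0 < n → (A : Digraph n) → IsOriented A →
     MinInDegreeAtLeast A α → HasDirectedTriangle A)

-- a k-colouring of the 3-subsets of [n], given as a symmetric function on triples
-- (its values on triples with repeated entries are irrelevant)
record Colouring3 (n k : ℕ) : Set where
  field
    col    : Fin n → Fin n → Fin n → Fin k
    sym₁₂  : ∀ x y z → col x y z ≡ col y x z
    sym₂₃  : ∀ x y z → col x y z ≡ col x z y

HasMonoLoosePath : ∀ {n k} → Colouring3 n k → Set
HasMonoLoosePath {n} χ =
  Σ (Fin 7 → Fin n) λ f → (Injective _≡_ _≡_ f ×
    (col (f (# 0)) (f (# 1)) (f (# 2)) ≡ col (f (# 2)) (f (# 3)) (f (# 4))) ×
    (col (f (# 2)) (f (# 3)) (f (# 4)) ≡ col (f (# 4)) (f (# 5)) (f (# 6))))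
  where open Colouring3 χ

Arrows : ℕ → ℕ → Set
Arrows n k = (χ : Colouring3 n k) → HasMonoLoosePath χ

IsRamseyNumberL : ℕ → ℕ → Set
IsRamseyNumberL k n = Arrows n k × ((m : ℕ) → m < n → ¬ Arrows m k)

{-# OPTIONS --safe #-}
-- Fix a colour of a colouring without a monochromatic loose path, and call a pair heavy if it lies in
-- at least 7 triples of that colour. The heavy pairs contain no path with three edges, so an arc from
-- u to v, drawn when u is the only heavy neighbour of v, gives every vertex at most one in-arc per
-- colour. All but O(n) triples of the colour either have a vertex with arcs to the other two or
-- contain a pair joined by arcs in both directions. Hence, taking all colours together, every vertex
-- has at most k in-arcs, and the oriented graph in which u beats v if there is an arc from v to u but
-- none from u to v has only O(n²) directed triangles, while nearly all of its in-degrees are at least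
-- n − k − o(n). If k is smaller than (1 − α − η) n, a random sample of bounded size misses all
-- these triangles and, after deletion of boundedly many vertices, has minimum in-degree at least
-- α times its size, contradicting the choice of α.
module Submission where

open import Defs

-- If every two vertices were joined by an arc, all in-degrees would be at least n - 1 - k at once;
-- pairs with no arc in any colour, called apart, are the obstacle. For an apart pair u, v each
-- colour has at most one edge uvw outside its O(n) exceptional triples, so at least n - k - 2
-- vertices w complete the pair to an exceptional triple. There are only O(n²) of these in all,
-- while n - k is linear in n; hence O(n) pairs are apart, and all but boundedly many vertices have
-- large in-degree. The definition of α asks for large in-degree at every vertex and yields just one
-- directed triangle, whereas here a few low vertices and O(n²) triangles remain. A sample of m + 1
-- vertices contains on average O(m³ / n) triangles and O(m / n) low vertices, both small for large
-- n. What is left are vertices whose in-degree deviates within the sample. By Chebyshev their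
-- expected number is bounded independently of m, so deleting them costs a constant, while the
-- surplus in-degree grows with m.

module LoosePaths where

  import Data.Fin as Fin
  import Data.Fin.Properties as Finₚ
  import Data.List.Membership.DecPropositional as DecMembership
  import Data.Nat.ListAction as ListAction
  import Data.Vec as Vec
  import Data.Vec.Properties as Vecₚ
  import Data.Vec.Relation.Unary.All as VecAll
  import Data.Vec.Relation.Unary.AllPairs as VecPairs
  open import Data.Empty using (⊥; ⊥-elim)
  open import Data.Bool using (true; if_then_else_)
  open import Data.Fin using (Fin; zero; suc; #_; _≟_; finToFun; funToFin)
  open import Data.Fin.Properties using (any?; all?; finToFun-funToFin)
  open import Data.List using (List; []; _∷_; length; map; filter; tabulate; lookup)
  open import Data.List.Membership.Propositional using (_∈_; _∉_)
  open import Data.List.Membership.Propositional.Properties using (∈-filter⁻; ∈-lookup)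
  open import Data.List.Properties using (map-tabulate; tabulate-lookup; length-filter)
  open import Data.List.Relation.Unary.All using (All; []; _∷_)
  open import Data.List.Relation.Unary.All.Properties using (¬Any⇒All¬)
  open import Data.List.Relation.Unary.Any using (here; there)
  open import Data.Nat using (ℕ; zero; suc; _≥_; _+_; _*_; _∸_; _^_; _≤_; _<_; z≤n; s≤s; nonZero; >-nonZero; _≤?_; _<?_)
  open import Data.Nat.DivMod using (_/_; _%_; m≡m%n+[m/n]*n; m%n<n)
  open import Data.Nat.Induction using (<-rec)
  open import Data.Nat.Properties hiding (_≟_)
  open import Data.Nat.Solver using (module +-*-Solver)
  open import Data.Product using (∃; ∃-syntax; _×_; _,_; proj₁; proj₂)
  open import Data.Sum using (_⊎_; inj₁; inj₂; [_,_]′)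
  open import Data.Vec using (Vec; []; _∷_)
  open import Data.Vec.Relation.Unary.Unique.Propositional.Properties using (lookup-injective)
  open import Function using (_∘_; id; flip)
  open import Function.Definitions using (Injective)
  open import Relation.Binary using (tri<; tri≈; tri>)
  open import Relation.Binary.PropositionalEquality using (_≡_; _≢_; refl;
    sym; trans; cong; cong₂; subst; subst₂; ≢-sym; module ≡-Reasoning)
  open import Relation.Nullary using (¬_; Dec; yes; no; does; contradiction; ¬?; _×-dec_; _⊎-dec_; _→-dec_)
  open import Relation.Nullary.Decidable using (map′; dec-false; decidable-stable)
  open import Algebra.Properties.Semiring.Sum +-*-semiring using (sum; ∑-distrib-+; ∑-comm; sum-cong-≗; *-distribˡ-sum)
  open +-*-Solver using (solve; con; _:=_; _:+_; _:*_)

  -- Finite sums and counting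

  𝟙 : {A : Set} → Dec A → ℕ
  𝟙 d = if does d then 1 else 0

  module _ {A : Set} where

    𝟙-true : (d : Dec A) → A → 𝟙 d ≡ 1
    𝟙-true (yes _) _ = refl
    𝟙-true (no ¬a) a = contradiction a ¬a

    1≤𝟙 : (d : Dec A) → A → 1 ≤ 𝟙 d
    1≤𝟙 d a = ≤-reflexive (sym (𝟙-true d a))

    𝟙-≤ : (d : Dec A) {x : ℕ} → (A → 1 ≤ x) → 𝟙 d ≤ x
    𝟙-≤ (yes a) h = h a
    𝟙-≤ (no _)  _ = z≤n

    𝟙≤1 : (d : Dec A) → 𝟙 d ≤ 1
    𝟙≤1 d = 𝟙-≤ d (λ _ → ≤-refl)

    𝟙-idem : (d : Dec A) → 𝟙 d * 𝟙 d ≡ 𝟙 d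
    𝟙-idem (yes _) = refl
    𝟙-idem (no _)  = refl

  𝟙-mono : {A B : Set} (d : Dec A) (e : Dec B) → (A → B) → 𝟙 d ≤ 𝟙 e
  𝟙-mono d e f = 𝟙-≤ d (λ a → 1≤𝟙 e (f a))

  sum-mono : ∀ {n} {f g : Fin n → ℕ} → (∀ i → f i ≤ g i) → sum f ≤ sum g
  sum-mono {zero}  h = z≤n
  sum-mono {suc n} h = +-mono-≤ (h zero) (sum-mono (h ∘ suc))

  sum-const : ∀ n c → sum {n} (λ _ → c) ≡ n * c
  sum-const zero    c = refl
  sum-const (suc n) c = cong (c +_) (sum-const n c)

  sum-≤-const : ∀ {n c} {f : Fin n → ℕ} → (∀ i → f i ≤ c) → sum f ≤ n * c
  sum-≤-const {n} {c} h = ≤-trans (sum-mono h) (≤-reflexive (sum-const n c))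

  size≤sum : ∀ {n} {f : Fin n → ℕ} → (∀ i → 1 ≤ f i) → n ≤ sum f
  size≤sum {zero}  h = z≤n
  size≤sum {suc n} h = +-mono-≤ (h zero) (size≤sum (h ∘ suc))

  term≤sum : ∀ {n} (f : Fin n → ℕ) i → f i ≤ sum f
  term≤sum f zero    = m≤m+n _ _
  term≤sum f (suc i) = ≤-trans (term≤sum (f ∘ suc) i) (m≤n+m _ _)

  sum-+₃ : ∀ {n} (f g h : Fin n → ℕ) → sum (λ i → f i + g i + h i) ≡ sum f + sum g + sum h
  sum-+₃ f g h = trans (∑-distrib-+ (λ i → f i + g i) h) (cong (_+ sum h) (∑-distrib-+ f g))

  sum₂-+ : ∀ {m n} (f g : Fin m → Fin n → ℕ) →
           sum (λ i → sum λ j → f i j + g i j) ≡ sum (λ i → sum (f i)) + sum (λ i → sum (g i))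
  sum₂-+ f g = trans (sum-cong-≗ λ i → ∑-distrib-+ (f i) (g i)) (∑-distrib-+ (λ i → sum (f i)) _)

  sum-<-witness : ∀ {n c} (f : Fin n → ℕ) → sum f < n * c → ∃ λ i → f i < c
  sum-<-witness {suc n} {c} f h with f zero <? c
  ... | yes p = zero , p
  ... | no ¬p = let i , q = sum-<-witness (f ∘ suc)
                              (+-cancelˡ-< c _ _ (≤-<-trans (+-monoˡ-≤ _ (≮⇒≥ ¬p)) h))
                in suc i , q

  module _ {n : ℕ} where

    open DecMembership (_≟_ {n}) using (_∈?_)

    sum-≡ : (a : Fin n) → sum (λ x → 𝟙 (x ≟ a)) ≤ 1
    sum-≡ = go
      where
      go : ∀ {n} (a : Fin n) → sum (λ x → 𝟙 (x ≟ a)) ≤ 1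
      go {suc n} zero    = s≤s (≤-trans (sum-≤-const {n} {0} (λ _ → ≤-refl)) (≤-reflexive (*-zeroʳ n)))
      go {suc n} (suc a) = ≤-trans (sum-mono {n} (λ x → 𝟙-mono (suc x ≟ suc a) (x ≟ a) λ { refl → refl })) (go a)

    sum-∈ : (l : List (Fin n)) → sum (λ x → 𝟙 (x ∈? l)) ≤ length l
    sum-∈ [] = ≤-trans (sum-≤-const {n} {0} (λ _ → ≤-refl)) (≤-reflexive (*-zeroʳ n))
    sum-∈ (a ∷ l) = begin
      sum (λ x → 𝟙 (x ∈? (a ∷ l)))              ≤⟨ sum-mono split ⟩
      sum (λ x → 𝟙 (x ≟ a) + 𝟙 (x ∈? l))        ≡⟨ ∑-distrib-+ (λ x → 𝟙 (x ≟ a)) _ ⟩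
      sum (λ x → 𝟙 (x ≟ a)) + sum (λ x → 𝟙 (x ∈? l)) ≤⟨ +-mono-≤ (sum-≡ a) (sum-∈ l) ⟩
      suc (length l)                            ∎
      where
      open ≤-Reasoning
      split : ∀ x → 𝟙 (x ∈? (a ∷ l)) ≤ 𝟙 (x ≟ a) + 𝟙 (x ∈? l)
      split x = 𝟙-≤ (x ∈? (a ∷ l)) λ
        { (here e)  → ≤-trans (1≤𝟙 (x ≟ a) e) (m≤m+n _ _)
        ; (there e) → ≤-trans (1≤𝟙 (x ∈? l) e) (m≤n+m _ _) }

    module _ {P : Fin n → Set} (P? : ∀ x → Dec (P x)) where

      count-⊆ : (l : List (Fin n)) → (∀ x → P x → x ∈ l) → sum (λ x → 𝟙 (P? x)) ≤ length l
      count-⊆ l h = ≤-trans (sum-mono λ x → 𝟙-mono (P? x) (x ∈? l) (h x)) (sum-∈ l)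

      count-unique : (∀ x y → P x → P y → x ≡ y) → sum (λ x → 𝟙 (P? x)) ≤ 1
      count-unique h with any? P?
      ... | yes (a , pa) = count-⊆ (a ∷ []) (λ x px → here (h x a px pa))
      ... | no ¬p        = ≤-trans (count-⊆ [] (λ x px → contradiction (x , px) ¬p)) z≤n

      count-avoid : (l : List (Fin n)) → length l < sum (λ x → 𝟙 (P? x)) → ∃ λ x → P x × x ∉ l
      count-avoid l h with any? (λ x → P? x ×-dec ¬? (x ∈? l))
      ... | yes r = r
      ... | no ¬r = contradiction (count-⊆ l inside) (<⇒≱ h)
        where
        inside : ∀ x → P x → x ∈ l
        inside x px with x ∈? l
        ... | yes i = i
        ... | no ¬i = contradiction (x , px , ¬i) ¬r

    module _ {P : Fin n → Fin n → Set} (P? : ∀ x y → Dec (P x y)) where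

      count₂ : ℕ
      count₂ = sum λ x → sum λ y → 𝟙 (P? x y)

      module _ {c : ℕ} (rows : ∀ x → sum (λ y → 𝟙 (P? x y)) ≤ c)
                       (cols : ∀ y → sum (λ x → 𝟙 (P? x y)) ≤ c) where

        -- A vertex of `l` is the first entry of at most `c` pairs and the second entry of at most
        -- `c`.
        count₂-hit : (l : List (Fin n)) → (∀ x y → P x y → x ∈ l ⊎ y ∈ l) →
                     count₂ ≤ length l * c + length l * c
        count₂-hit l hit = begin
          count₂
            ≤⟨ sum-mono (λ x → sum-mono λ y → split x y) ⟩
          sum (λ x → sum λ y → p x * q x y + p y * q x y)
            ≡⟨ sum₂-+ (λ x y → p x * q x y) (λ x y → p y * q x y) ⟩
          sum (λ x → sum (λ y → p x * q x y)) + sum (λ x → sum (λ y → p y * q x y))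
            ≡⟨ cong (sum (λ x → sum (λ y → p x * q x y)) +_) (∑-comm λ x y → p y * q x y) ⟩
          sum (λ x → sum (λ y → p x * q x y)) + sum (λ y → sum (λ x → p y * q x y))
            ≤⟨ +-mono-≤ (lines q rows) (lines (flip q) cols) ⟩
          length l * c + length l * c ∎
          where
          open ≤-Reasoning
          p : Fin n → ℕ
          p x = 𝟙 (x ∈? l)
          q : Fin n → Fin n → ℕ
          q x y = 𝟙 (P? x y)
          split : ∀ x y → q x y ≤ p x * q x y + p y * q x y
          split x y with P? x y
          ... | no _  = z≤n
          ... | yes h = [ (λ i → subst (λ a → 1 ≤ a * 1 + p y * 1) (sym (𝟙-true (x ∈? l) i)) (s≤s z≤n))
                        , (λ i → subst (λ a → 1 ≤ p x * 1 + a * 1) (sym (𝟙-true (y ∈? l) i)) (m≤n+m 1 _)) ]′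
                        (hit x y h)
          lines : (g : Fin n → Fin n → ℕ) → (∀ x → sum (g x) ≤ c) →
                  sum (λ x → sum (λ y → p x * g x y)) ≤ length l * c
          lines g g≤ = begin
            sum (λ x → sum (λ y → p x * g x y)) ≡⟨ sum-cong-≗ (λ x → sym (*-distribˡ-sum (p x) (g x))) ⟩
            sum (λ x → p x * sum (g x))         ≤⟨ sum-mono (λ x → *-monoʳ-≤ (p x) (g≤ x)) ⟩
            sum (λ x → p x * c)                 ≡⟨ sum-cong-≗ (λ x → *-comm (p x) c) ⟩
            sum (λ x → c * p x)                 ≡⟨ sym (*-distribˡ-sum c p) ⟩
            c * sum p                           ≤⟨ *-monoʳ-≤ c (sum-∈ l) ⟩
            c * length l                        ≡⟨ *-comm c _ ⟩
            length l * c                        ∎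

        count₂-avoid : (l : List (Fin n)) → length l * c + length l * c < count₂ →
                       ∃ λ x → ∃ λ y → P x y × x ∉ l × y ∉ l
        count₂-avoid l h
          with any? (λ x → any? λ y → P? x y ×-dec ¬? (x ∈? l) ×-dec ¬? (y ∈? l))
        ... | yes r = r
        ... | no ¬r = contradiction (count₂-hit l hit) (<⇒≱ h)
          where
          hit : ∀ x y → P x y → x ∈ l ⊎ y ∈ l
          hit x y p with x ∈? l | y ∈? l
          ... | yes i | _     = inj₁ i
          ... | no _  | yes j = inj₂ j
          ... | no i  | no j  = contradiction (x , y , p , i , j) ¬r

        -- Any one pair of `P` is a set of two vertices that hits all the others.
        count₂-intersecting :
          (∀ x y u v → P x y → P u v → (u ∈ x ∷ y ∷ []) ⊎ (v ∈ x ∷ y ∷ [])) →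
          count₂ ≤ 2 * c + 2 * c
        count₂-intersecting meet with any? (λ x → any? (P? x))
        ... | yes (x , y , p) = count₂-hit (x ∷ y ∷ []) (λ u v → meet x y u v p)
        ... | no ¬p = ≤-trans (count₂-hit [] λ u v q → contradiction (u , v , q) ¬p) z≤n

      count₂-⊆ : ((x y : Fin n) → P x y → ∀ u v → P u v → u ∈ x ∷ y ∷ [] × v ∈ x ∷ y ∷ []) →
                 count₂ ≤ 4
      count₂-⊆ inside with any? (λ x → any? (P? x))
      ... | no ¬p = ≤-trans (sum-≤-const {n} {0} λ x →
                      ≤-trans (sum-≤-const {n} {0} λ y → 𝟙-≤ (P? x y) λ p → contradiction (x , y , p) ¬p)
                              (≤-reflexive (*-zeroʳ n)))
                      (≤-trans (≤-reflexive (*-zeroʳ n)) z≤n)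
      ... | yes (x , y , p) = begin
        count₂                                       ≤⟨ sum-mono row ⟩
        sum (λ u → 2 * 𝟙 (u ∈? (x ∷ y ∷ [])))        ≡⟨ sym (*-distribˡ-sum 2 λ u → 𝟙 (u ∈? (x ∷ y ∷ []))) ⟩
        2 * sum (λ u → 𝟙 (u ∈? (x ∷ y ∷ [])))        ≤⟨ *-monoʳ-≤ 2 (sum-∈ (x ∷ y ∷ [])) ⟩
        4                                            ∎
        where
        open ≤-Reasoning
        row : ∀ u → sum (λ v → 𝟙 (P? u v)) ≤ 2 * 𝟙 (u ∈? (x ∷ y ∷ []))
        row u = cases (u ∈? (x ∷ y ∷ []))
          where
          cases : (d : Dec (u ∈ x ∷ y ∷ [])) → sum (λ v → 𝟙 (P? u v)) ≤ 2 * 𝟙 d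
          cases (yes _) = count-⊆ (P? u) (x ∷ y ∷ []) (λ v q → proj₂ (inside x y p u v q))
          cases (no ∉)  = count-⊆ (P? u) [] (λ v q → contradiction (proj₁ (inside x y p u v q)) ∉)

  -- Colour classes without a loose path

  module ColourClass {n k : ℕ} (χ : Colouring3 n k) (no-mono : ¬ HasMonoLoosePath χ) where

    open Colouring3 χ

    record Edge (i : Fin k) (x y z : Fin n) : Set where
      constructor edge
      field
        ≢₁₂ : x ≢ y
        ≢₂₃ : y ≢ z
        ≢₁₃ : x ≢ z
        coloured : col x y z ≡ i

    open Edge

    Edge? : ∀ i x y z → Dec (Edge i x y z)
    Edge? i x y z = map′ (λ (p , q , r , s) → edge p q r s) (λ (edge p q r s) → p , q , r , s)
      (¬? (x ≟ y) ×-dec ¬? (y ≟ z) ×-dec ¬? (x ≟ z) ×-dec (col x y z ≟ i))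

    module _ {i : Fin k} {x y z : Fin n} where

      swap₁₂ : Edge i x y z → Edge i y x z
      swap₁₂ (edge p q r s) = edge (≢-sym p) r q (trans (sym (sym₁₂ x y z)) s)

      swap₂₃ : Edge i x y z → Edge i x z y
      swap₂₃ (edge p q r s) = edge r (≢-sym q) p (trans (sym (sym₂₃ x y z)) s)

    rotate : ∀ {i x y z} → Edge i x y z → Edge i y z x
    rotate = swap₂₃ ∘ swap₁₂

    -- Of the 21 inequalities between seven vertices, nine lie inside the three edges; the other
    -- twelve are hypotheses.
    no-path : ∀ {i a b c d e f g} → Edge i a b c → Edge i c d e → Edge i e f g →
      a ≢ d → a ≢ e → a ≢ f → a ≢ g → b ≢ d → b ≢ e → b ≢ f → b ≢ g →
      c ≢ f → c ≢ g → d ≢ f → d ≢ g → ⊥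
    no-path {a = a} {b} {c} {d} {e} {f} {g} E₁ E₂ E₃ ad ae af ag bd be bf bg cf cg df dg =
      no-mono (Vec.lookup vs , lookup-injective distinct _ _
              , trans (coloured E₁) (sym (coloured E₂)) , trans (coloured E₂) (sym (coloured E₃)))
      where
      vs = a ∷ b ∷ c ∷ d ∷ e ∷ f ∷ g ∷ []
      distinct =
        (≢₁₂ E₁ VecAll.∷ ≢₁₃ E₁ VecAll.∷ ad VecAll.∷ ae VecAll.∷ af VecAll.∷ ag VecAll.∷ VecAll.[]) VecPairs.∷
        (≢₂₃ E₁ VecAll.∷ bd VecAll.∷ be VecAll.∷ bf VecAll.∷ bg VecAll.∷ VecAll.[]) VecPairs.∷
        (≢₁₂ E₂ VecAll.∷ ≢₁₃ E₂ VecAll.∷ cf VecAll.∷ cg VecAll.∷ VecAll.[]) VecPairs.∷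
        (≢₂₃ E₂ VecAll.∷ df VecAll.∷ dg VecAll.∷ VecAll.[]) VecPairs.∷
        (≢₁₂ E₃ VecAll.∷ ≢₁₃ E₃ VecAll.∷ VecAll.[]) VecPairs.∷
        (≢₂₃ E₃ VecAll.∷ VecAll.[]) VecPairs.∷
        VecAll.[] VecPairs.∷ VecPairs.[]

    codegree : Fin k → Fin n → Fin n → ℕ
    codegree i u v = sum λ w → 𝟙 (Edge? i u v w)

    -- A loose path through three given pairs needs three further vertices, each avoiding
    -- at most six others.
    record Heavy (i : Fin k) (u v : Fin n) : Set where
      constructor heavy
      field 7≤codegree : 7 ≤ codegree i u v

    Heavy? : ∀ i u v → Dec (Heavy i u v)
    Heavy? i u v = map′ heavy Heavy.7≤codegree (7 ≤? codegree i u v)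

    Heavy-sym : ∀ {i u v} → Heavy i u v → Heavy i v u
    Heavy-sym {i} {u} {v} (heavy h) =
      heavy (≤-trans h (sum-mono λ w → 𝟙-mono (Edge? i u v w) (Edge? i v u w) swap₁₂))

    extend : ∀ {i u v} → Heavy i u v → (l : List (Fin n)) → length l ≤ 6 →
             ∃ λ w → Edge i u v w × All (w ≢_) l
    extend {i} {u} {v} (heavy h) l l≤ =
      let w , e , w∉ = count-avoid (Edge? i u v) l (≤-trans (s≤s l≤) h)
      in w , e , ¬Any⇒All¬ l w∉

    Heavy-irrefl : ∀ {i u v} → Heavy i u v → u ≢ v
    Heavy-irrefl h = let _ , e , _ = extend h [] z≤n in ≢₁₂ e

    -- Heaviness depends on the pair `u`, `v` alone, so a single `w` with `P w` already makes the
    -- codegree at most 6.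
    row-light : ∀ {i u v} {P : Fin n → Set} (P? : ∀ w → Dec (P w)) →
                (∀ w → P w → Edge i u v w × ¬ Heavy i u v) → sum (λ w → 𝟙 (P? w)) ≤ 6
    row-light {i} {u} {v} P? h with Heavy? i u v
    ... | yes uv = ≤-trans (count-⊆ P? [] (λ w p → contradiction uv (proj₂ (h w p)))) z≤n
    ... | no ¬uv = ≤-trans (sum-mono λ w → 𝟙-mono (P? w) (Edge? i u v w) (proj₁ ∘ h w))
                           (≤-pred (≰⇒> λ p → ¬uv (heavy p)))

    -- Three fresh vertices turn the path into the loose path `axb`, `byc`, `czd`. Hence the heavy
    -- pairs of a colour form disjoint stars and triangles.
    no-heavy-path : ∀ {i a b c d} → Heavy i a b → Heavy i b c → Heavy i c d →
                    a ≢ c → a ≢ d → b ≢ d → ⊥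
    no-heavy-path {a = a} {b} {c} {d} ab bc cd a≢c a≢d b≢d
      with extend ab (c ∷ d ∷ []) (m≤m+n 2 4)
    ... | x , abx , x≢c ∷ x≢d ∷ []
      with extend bc (a ∷ d ∷ x ∷ []) (m≤m+n 3 3)
    ... | y , bcy , y≢a ∷ y≢d ∷ y≢x ∷ []
      with extend cd (a ∷ b ∷ x ∷ y ∷ []) (m≤m+n 4 2)
    ... | z , cdz , z≢a ∷ z≢b ∷ z≢x ∷ z≢y ∷ [] =
      no-path (swap₂₃ abx) (swap₂₃ bcy) (swap₂₃ cdz)
        (≢-sym y≢a) a≢c (≢-sym z≢a) a≢d (≢-sym y≢x) x≢c (≢-sym z≢x) x≢d
        (≢-sym z≢b) b≢d (≢-sym z≢y) y≢d

    -- The loose path is `stw`, `wuv`, `vqz`; only its last edge has to be found.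
    no-pendant-path : ∀ {i s t w u v q} → Edge i s t w → Edge i w u v → Heavy i v q →
                      All (s ≢_) (u ∷ v ∷ q ∷ []) → All (t ≢_) (u ∷ v ∷ q ∷ []) → w ≢ q → u ≢ q → ⊥
    no-pendant-path {s = s} {t} {w} {u} stw wuv vq
      (s≢u ∷ s≢v ∷ s≢q ∷ []) (t≢u ∷ t≢v ∷ t≢q ∷ []) w≢q u≢q
      with extend vq (s ∷ t ∷ w ∷ u ∷ []) (m≤m+n 4 2)
    ... | z , vqz , z≢s ∷ z≢t ∷ z≢w ∷ z≢u ∷ [] =
      no-path stw wuv vqz s≢u s≢v s≢q (≢-sym z≢s) t≢u t≢v t≢q (≢-sym z≢t)
        w≢q (≢-sym z≢w) u≢q (≢-sym z≢u)

    -- In a star of at least two heavy pairs the arcs run from the centre to the leaves. A component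
    -- that is a single heavy pair carries both arcs, and a heavy triangle none.
    record Arc (i : Fin k) (u v : Fin n) : Set where
      constructor arc
      field
        pair  : Heavy i u v
        only  : ∀ q → Heavy i q v → q ≡ u

    open Arc

    Arc? : ∀ i u v → Dec (Arc i u v)
    Arc? i u v = map′ (λ (h , o) → arc h o) (λ (arc h o) → h , o)
      (Heavy? i u v ×-dec all? (λ q → Heavy? i q v →-dec (q ≟ u)))

    Mutual : Fin k → Fin n → Fin n → Set
    Mutual i u v = Arc i u v × Arc i v u

    Mutual? : ∀ i u v → Dec (Mutual i u v)
    Mutual? i u v = Arc? i u v ×-dec Arc? i v u

    another : ∀ {i u v} → Heavy i u v → ¬ Arc i u v → ∃ λ q → Heavy i q v × q ≢ u
    another {i} {u} {v} h ¬a with any? (λ q → Heavy? i q v ×-dec ¬? (q ≟ u))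
    ... | yes r = r
    ... | no ¬r = contradiction (arc h only′) ¬a
      where
      only′ : ∀ q → Heavy i q v → q ≡ u
      only′ q hq with q ≟ u
      ... | yes e = e
      ... | no ne = contradiction (q , hq , ne) ¬r

    -- An edge is useful if it contains a star of two arcs or a mutual pair. The first three kinds
    -- below are the edges that may be useless, the fourth those that spoil apart-bound; each is
    -- charged to a vertex w, and w is charged boundedly often in each colour: for the last three
    -- kinds, because any two pairs {u, v} charged to w meet.

    Light : Fin k → Fin n → Fin n → Fin n → Set
    Light i w u v = Edge i w u v × ¬ Heavy i w u × ¬ Heavy i w v × ¬ Heavy i u v

    Light? : ∀ i w u v → Dec (Light i w u v)
    Light? i w u v = Edge? i w u v ×-dec ¬? (Heavy? i w u) ×-dec ¬? (Heavy? i w v) ×-dec ¬? (Heavy? i u v)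

    -- 48 = 4 · (6 + 6): an extension of a path has to avoid four vertices, each lying on at most
    -- six light edges {w, u, v} as u and six as v.
    LightLow : Fin k → Fin n → Fin n → Fin n → Set
    LightLow i w u v = Light i w u v × count₂ (Light? i w) ≤ 48

    LightLow? : ∀ i w u v → Dec (LightLow i w u v)
    LightLow? i w u v = Light? i w u v ×-dec (count₂ (Light? i w) ≤? 48)

    Pendant : Fin k → Fin n → Fin n → Fin n → Set
    Pendant i w u v = Edge i w u v × Heavy i u v × ¬ Heavy i w u × ¬ Heavy i w v × ¬ Mutual i u v

    Pendant? : ∀ i w u v → Dec (Pendant i w u v)
    Pendant? i w u v = Edge? i w u v ×-dec Heavy? i u v ×-dec ¬? (Heavy? i w u) ×-dec ¬? (Heavy? i w v)
                       ×-dec ¬? (Mutual? i u v)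

    Triangle : Fin k → Fin n → Fin n → Fin n → Set
    Triangle i w u v = Edge i w u v × Heavy i w u × Heavy i w v × Heavy i u v

    Triangle? : ∀ i w u v → Dec (Triangle i w u v)
    Triangle? i w u v = Edge? i w u v ×-dec Heavy? i w u ×-dec Heavy? i w v ×-dec Heavy? i u v

    -- The pair `v`, `w` lies in two edges, whose third vertices `u` and `q` are mutual with `v` and
    -- `w` respectively. This is the one configuration in which two useful edges on an apart pair do
    -- not share the target of an arc.
    Crossed : Fin k → Fin n → Fin n → Fin n → Set
    Crossed i w u v = Edge i w u v × Mutual i u v × ∃ λ q → Edge i v w q × q ≢ u × Mutual i w q

    Crossed? : ∀ i w u v → Dec (Crossed i w u v)
    Crossed? i w u v = Edge? i w u v ×-dec Mutual? i u v
      ×-dec any? (λ q → Edge? i v w q ×-dec ¬? (q ≟ u) ×-dec Mutual? i w q)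

    Light-rows : ∀ i w u → sum (λ v → 𝟙 (Light? i w u v)) ≤ 6
    Light-rows i w u = row-light (Light? i w u) λ v (e , wu , _) → e , wu

    Light-cols : ∀ i w v → sum (λ u → 𝟙 (Light? i w u v)) ≤ 6
    Light-cols i w v = row-light (λ u → Light? i w u v) λ u (e , _ , wv , _) → swap₂₃ e , wv

    -- Otherwise `xya`, `acb`, `bfg` is a loose path: `x`, `y` must avoid two vertices, which
    -- excludes at most 24 pairs, and `f`, `g` four, which excludes at most 48. So one of any two
    -- vertices of a light edge can be charged.
    Light-low : ∀ {i a b c} → Light i a b c → 48 < count₂ (Light? i a) → 48 < count₂ (Light? i b) → ⊥
    Light-low {i} {a} {b} {c} (abc , _) da db
      with count₂-avoid (Light? i a) (Light-rows i a) (Light-cols i a) (b ∷ c ∷ []) (≤-trans (m≤m+n 25 24) da)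
    ... | x , y , (axy , _) , x∉ , y∉
      with ¬Any⇒All¬ _ x∉ | ¬Any⇒All¬ _ y∉
         | count₂-avoid (Light? i b) (Light-rows i b) (Light-cols i b) (a ∷ c ∷ x ∷ y ∷ []) db
    ... | x≢b ∷ x≢c ∷ [] | y≢b ∷ y≢c ∷ [] | f , g , (bfg , _) , f∉ , g∉
      with ¬Any⇒All¬ _ f∉ | ¬Any⇒All¬ _ g∉
    ... | f≢a ∷ f≢c ∷ f≢x ∷ f≢y ∷ [] | g≢a ∷ g≢c ∷ g≢x ∷ g≢y ∷ [] =
      no-path (rotate axy) (swap₂₃ abc) bfg x≢c x≢b (≢-sym f≢x) (≢-sym g≢x) y≢c y≢b (≢-sym f≢y) (≢-sym g≢y)
        (≢-sym f≢a) (≢-sym g≢a) (≢-sym f≢c) (≢-sym g≢c)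

    LightLow-count : ∀ i w → count₂ (LightLow? i w) ≤ 48
    LightLow-count i w with count₂ (Light? i w) ≤? 48
    ... | yes p = ≤-trans (sum-mono λ u → sum-mono λ v → 𝟙-mono (LightLow? i w u v) (Light? i w u v) proj₁) p
    ... | no ¬p = ≤-trans (count₂-⊆ (LightLow? i w) λ _ _ (_ , p) → contradiction p ¬p) (m≤m+n 4 44)

    -- As `x`, `y` is not mutual, one of them, say `y`, has another heavy neighbour `q`. If a second
    -- pendant edge `wuv` met the first only in `w`, then `uvw`, `wxy`, `yqz` would be a loose path.
    Pendant-count : ∀ i w → count₂ (Pendant? i w) ≤ 24
    Pendant-count i w = count₂-intersecting (Pendant? i w)
      (λ u → row-light (Pendant? i w u) λ v (e , _ , wu , _) → e , wu)
      (λ v → row-light (λ u → Pendant? i w u v) λ u (e , _ , _ , wv , _) → swap₂₃ e , wv)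
      meet
      where
      open DecMembership (_≟_ {n}) using (_∈?_)

      disjoint : ∀ {x y u v} → Edge i w x y → Heavy i x y → ¬ Heavy i w y → ¬ Arc i x y →
                 Edge i w u v → Heavy i u v → u ≢ x → u ≢ y → v ≢ x → v ≢ y → ⊥
      disjoint wxy xy ¬wy ¬a wuv uv u≢x u≢y v≢x v≢y =
        let q , qy , q≢x = another xy ¬a
            -- If `q` were `u` or `v`, the heavy pair `uv` would prolong `xy`, `yq` to a heavy path
            -- with three edges.
            q≢u = λ q≡u → no-heavy-path xy (Heavy-sym (subst (λ q → Heavy i q _) q≡u qy)) uv
                            (≢-sym u≢x) (≢-sym v≢x) (≢-sym v≢y)
            q≢v = λ q≡v → no-heavy-path xy (Heavy-sym (subst (λ q → Heavy i q _) q≡v qy)) (Heavy-sym uv)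
                            (≢-sym v≢x) (≢-sym u≢x) (≢-sym u≢y)
            w≢q = λ w≡q → ¬wy (subst (λ q → Heavy i q _) (sym w≡q) qy)
        in no-pendant-path (rotate wuv) wxy (Heavy-sym qy)
             (u≢x ∷ u≢y ∷ ≢-sym q≢u ∷ []) (v≢x ∷ v≢y ∷ ≢-sym q≢v ∷ []) w≢q (≢-sym q≢x)

      meet : ∀ x y u v → Pendant i w x y → Pendant i w u v → u ∈ x ∷ y ∷ [] ⊎ v ∈ x ∷ y ∷ []
      meet x y u v (wxy , xy , ¬wx , ¬wy , ¬m) (wuv , uv , _)
        with u ∈? (x ∷ y ∷ []) | v ∈? (x ∷ y ∷ [])
      ... | yes p | _     = inj₁ p
      ... | no _  | yes q = inj₂ q
      ... | no u∉ | no v∉ with ¬Any⇒All¬ _ u∉ | ¬Any⇒All¬ _ v∉ | Arc? i x y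
      ... | u≢x ∷ u≢y ∷ [] | v≢x ∷ v≢y ∷ [] | no ¬a =
        ⊥-elim (disjoint wxy xy ¬wy ¬a wuv uv u≢x u≢y v≢x v≢y)
      ... | u≢x ∷ u≢y ∷ [] | v≢x ∷ v≢y ∷ [] | yes a =
        ⊥-elim (disjoint (swap₂₃ wxy) (Heavy-sym xy) ¬wx (λ b → ¬m (a , b)) wuv uv u≢y u≢x v≢y v≢x)

    -- A heavy neighbour `u` of `w` outside the heavy triangle `wxy` would give the heavy path `u`,
    -- `w`, `x`, `y`.
    Triangle-count : ∀ i w → count₂ (Triangle? i w) ≤ 4
    Triangle-count i w = count₂-⊆ (Triangle? i w) λ x y t u v (wuv , wu , wv , uv) →
      inside t wu , inside t wv
      where
      open DecMembership (_≟_ {n}) using (_∈?_)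
      inside : ∀ {x y u} → Triangle i w x y → Heavy i w u → u ∈ x ∷ y ∷ []
      inside {x} {y} {u} (wxy , wx , wy , xy) wu with u ∈? (x ∷ y ∷ [])
      ... | yes p = p
      ... | no u∉ with ¬Any⇒All¬ _ u∉
      ... | u≢x ∷ u≢y ∷ [] = ⊥-elim (no-heavy-path (Heavy-sym wu) wx xy u≢x u≢y (≢₁₃ wxy))

    -- `q` and `p` are both the only heavy neighbour of `w`, so they coincide. If the mutual pairs
    -- `xy` and `uv` were disjoint, `xyw`, `wqu`, `uvz` would be a loose path; if they meet they are
    -- equal, because a mutual pair is isolated among the heavy pairs.
    Crossed-count : ∀ i w → count₂ (Crossed? i w) ≤ 4
    Crossed-count i w = count₂-⊆ (Crossed? i w) λ x y p u v r → let v∈ , u∈ = inside p r in u∈ , v∈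
      where
      inside : ∀ {x y u v} → Crossed i w x y → Crossed i w v u → u ∈ x ∷ y ∷ [] × v ∈ x ∷ y ∷ []
      inside {x} {y} {u} {v} (wxy , (x→y , y→x) , q , _ , _ , w→q , q→w)
                             (wvu , (v→u , u→v) , p , uwp , p≢v , w→p , p→w)
        with u ≟ x | u ≟ y
      ... | yes u≡x | _ = here u≡x , there (here (sym (only v→u y (subst (Heavy i y) (sym u≡x) (pair y→x)))))
      ... | no _ | yes u≡y = there (here u≡y) , here (sym (only v→u x (subst (Heavy i x) (sym u≡y) (pair x→y))))
      ... | no u≢x | no u≢y with extend (pair u→v) (x ∷ y ∷ w ∷ q ∷ []) (m≤m+n 4 2)
      ... | z , uvz , z≢x ∷ z≢y ∷ z≢w ∷ z≢q ∷ [] =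
        ⊥-elim (no-path (rotate wxy) (rotate (subst (Edge i u w) p≡q uwp)) uvz
          x≢q (≢-sym u≢x) x≢v (≢-sym z≢x)
          y≢q (≢-sym u≢y) y≢v (≢-sym z≢y)
          (≢₁₂ wvu) (≢-sym z≢w) (subst (_≢ v) p≡q p≢v) (≢-sym z≢q))
        where
        p≡q = only q→w p (pair p→w)
        x≢q : x ≢ q
        x≢q x≡q = ≢₁₃ wxy (sym (only w→q y (subst (Heavy i y) x≡q (pair y→x))))
        y≢q : y ≢ q
        y≢q y≡q = ≢₁₂ wxy (sym (only w→q x (subst (Heavy i x) y≡q (pair x→y))))
        x≢v : x ≢ v
        x≢v x≡v = u≢y (sym (only u→v y (subst (Heavy i y) x≡v (pair y→x))))
        y≢v : y ≢ v
        y≢v y≡v = u≢x (sym (only u→v x (subst (Heavy i x) y≡v (pair x→y))))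

    data Charged (i : Fin k) (w u v : Fin n) : Set where
      light    : LightLow i w u v → Charged i w u v
      pendant  : Pendant i w u v → Charged i w u v
      triangle : Triangle i w u v → Charged i w u v
      crossed  : Crossed i w u v → Charged i w u v

    Charged? : ∀ i w u v → Dec (Charged i w u v)
    Charged? i w u v = map′
      [ light , [ pendant , [ triangle , crossed ]′ ]′ ]′
      (λ { (light p) → inj₁ p ; (pendant p) → inj₂ (inj₁ p)
         ; (triangle p) → inj₂ (inj₂ (inj₁ p)) ; (crossed p) → inj₂ (inj₂ (inj₂ p)) })
      (LightLow? i w u v ⊎-dec Pendant? i w u v ⊎-dec Triangle? i w u v ⊎-dec Crossed? i w u v)

    -- The four kinds contribute 48 + 24 + 4 + 4.
    Charged-count : ∀ i w → count₂ (Charged? i w) ≤ 80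
    Charged-count i w = begin
      count₂ (Charged? i w)
        ≤⟨ sum-mono (λ u → sum-mono λ v → split u v) ⟩
      sum (λ u → sum λ v → a u v + b u v + c u v + d u v)
        ≡⟨ sum₂-+ (λ u v → a u v + b u v + c u v) d ⟩
      sum (λ u → sum λ v → a u v + b u v + c u v) + count₂ (Crossed? i w)
        ≡⟨ cong (_+ count₂ (Crossed? i w)) (sum₂-+ (λ u v → a u v + b u v) c) ⟩
      sum (λ u → sum λ v → a u v + b u v) + count₂ (Triangle? i w) + count₂ (Crossed? i w)
        ≡⟨ cong (λ s → s + count₂ (Triangle? i w) + count₂ (Crossed? i w)) (sum₂-+ a b) ⟩
      count₂ (LightLow? i w) + count₂ (Pendant? i w) + count₂ (Triangle? i w) + count₂ (Crossed? i w)
        ≤⟨ +-mono-≤ (+-mono-≤ (+-mono-≤ (LightLow-count i w) (Pendant-count i w)) (Triangle-count i w)) (Crossed-count i w) ⟩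
      80 ∎
      where
      open ≤-Reasoning
      a b c d : Fin n → Fin n → ℕ
      a u v = 𝟙 (LightLow? i w u v)
      b u v = 𝟙 (Pendant? i w u v)
      c u v = 𝟙 (Triangle? i w u v)
      d u v = 𝟙 (Crossed? i w u v)
      split : ∀ u v → 𝟙 (Charged? i w u v) ≤ a u v + b u v + c u v + d u v
      split u v = 𝟙-≤ (Charged? i w u v) λ
        { (light p)    → ≤-trans (1≤𝟙 (LightLow? i w u v) p)
                           (≤-trans (m≤m+n _ _) (≤-trans (m≤m+n _ _) (m≤m+n _ _)))
        ; (pendant p)  → ≤-trans (1≤𝟙 (Pendant? i w u v) p)
                           (≤-trans (m≤n+m _ (a u v)) (≤-trans (m≤m+n _ _) (m≤m+n _ _)))
        ; (triangle p) → ≤-trans (1≤𝟙 (Triangle? i w u v) p)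
                           (≤-trans (m≤n+m _ (a u v + b u v)) (m≤m+n _ _))
        ; (crossed p)  → ≤-trans (1≤𝟙 (Crossed? i w u v) p)
                           (m≤n+m _ (a u v + b u v + c u v)) }

    -- Classification of the edges of one colour

    Star : Fin k → Fin n → Fin n → Fin n → Set
    Star i x y z = Arc i x y × Arc i x z

    data Useful (i : Fin k) (u v w : Fin n) : Set where
      star₁ : Star i u v w → Useful i u v w
      star₂ : Star i v w u → Useful i u v w
      star₃ : Star i w u v → Useful i u v w
      mutual₁₂ : Mutual i u v → Useful i u v w
      mutual₂₃ : Mutual i v w → Useful i u v w
      mutual₃₁ : Mutual i w u → Useful i u v w

    data Exceptional (i : Fin k) (u v w : Fin n) : Set where
      charged₁ : Charged i u v w → Exceptional i u v w
      charged₂ : Charged i v w u → Exceptional i u v w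
      charged₃ : Charged i w u v → Exceptional i u v w

    Exceptional? : ∀ i u v w → Dec (Exceptional i u v w)
    Exceptional? i u v w = map′
      [ charged₁ , [ charged₂ , charged₃ ]′ ]′
      (λ { (charged₁ p) → inj₁ p ; (charged₂ p) → inj₂ (inj₁ p) ; (charged₃ p) → inj₂ (inj₂ p) })
      (Charged? i u v w ⊎-dec Charged? i v w u ⊎-dec Charged? i w u v)

    -- A further heavy neighbour `q` of `y` would give the heavy path `q`, `y`, `x`, `z`; it differs
    -- from `z` since `y`, `z` is not heavy.
    star-of : ∀ {i x y z} → Heavy i x y → Heavy i x z → y ≢ z → ¬ Heavy i y z → Star i x y z
    star-of {i} {x} xy xz y≢z ¬yz = leaf xy xz y≢z ¬yz , leaf xz xy (≢-sym y≢z) (¬yz ∘ Heavy-sym)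
      where
      leaf : ∀ {y z} → Heavy i x y → Heavy i x z → y ≢ z → ¬ Heavy i y z → Arc i x y
      leaf {y} {z} xy xz y≢z ¬yz = arc xy only′
        where
        only′ : ∀ q → Heavy i q y → q ≡ x
        only′ q qy with q ≟ x
        ... | yes e = e
        ... | no q≢x = ⊥-elim (no-heavy-path qy (Heavy-sym xy) xz q≢x
                (λ q≡z → ¬yz (Heavy-sym (subst (λ q → Heavy i q y) q≡z qy))) y≢z)

    pair-of : ∀ {i w u v} → Edge i w u v → Heavy i u v → ¬ Heavy i w u → ¬ Heavy i w v →
              Charged i w u v ⊎ Mutual i u v
    pair-of {i} {w} {u} {v} e uv ¬wu ¬wv with Mutual? i u v
    ... | yes m = inj₂ m
    ... | no ¬m = inj₁ (pendant (e , uv , ¬wu , ¬wv , ¬m))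

    light-of : ∀ {i u v w} → Light i u v w → Charged i u v w ⊎ Charged i v w u
    light-of {i} {u} {v} l@(e , ¬uv , ¬uw , ¬vw) with count₂ (Light? i u) ≤? 48 | count₂ (Light? i v) ≤? 48
    ... | yes p | _     = inj₁ (light (l , p))
    ... | no _  | yes q = inj₂ (light ((rotate e , ¬vw , ¬uv ∘ Heavy-sym , ¬uw ∘ Heavy-sym) , q))
    ... | no ¬p | no ¬q = ⊥-elim (Light-low l (≰⇒> ¬p) (≰⇒> ¬q))

    -- By the number of heavy pairs in the edge: three form a heavy triangle, two a star, one is
    -- mutual or makes the edge pendant, and none makes it light.
    classify : ∀ {i u v w} → Edge i u v w → Exceptional i u v w ⊎ Useful i u v w
    classify {i} {u} {v} {w} e with Heavy? i u v | Heavy? i v w | Heavy? i w u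
    ... | yes uv | yes vw | yes wu = inj₁ (charged₁ (triangle (e , uv , Heavy-sym wu , vw)))
    ... | yes uv | yes vw | no ¬wu = inj₂ (star₂ (star-of vw (Heavy-sym uv) (≢-sym (≢₁₃ e)) ¬wu))
    ... | yes uv | no ¬vw | yes wu = inj₂ (star₁ (star-of uv (Heavy-sym wu) (≢₂₃ e) ¬vw))
    ... | no ¬uv | yes vw | yes wu = inj₂ (star₃ (star-of wu (Heavy-sym vw) (≢₁₂ e) ¬uv))
    ... | yes uv | no ¬vw | no ¬wu = [ inj₁ ∘ charged₃ , inj₂ ∘ mutual₁₂ ]′
            (pair-of (rotate (rotate e)) uv ¬wu (¬vw ∘ Heavy-sym))
    ... | no ¬uv | yes vw | no ¬wu = [ inj₁ ∘ charged₁ , inj₂ ∘ mutual₂₃ ]′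
            (pair-of e vw ¬uv (¬wu ∘ Heavy-sym))
    ... | no ¬uv | no ¬vw | yes wu = [ inj₁ ∘ charged₂ , inj₂ ∘ mutual₃₁ ]′
            (pair-of (rotate e) wu ¬vw (¬uv ∘ Heavy-sym))
    ... | no ¬uv | no ¬vw | no ¬wu = inj₁ ([ charged₁ , charged₂ ]′
            (light-of (e , ¬uv , ¬wu ∘ Heavy-sym , ¬vw)))

    -- The oriented graph of all colours together

    infix 4 _⟶_ _⟶?_

    _⟶_ : Fin n → Fin n → Set
    u ⟶ v = ∃ λ i → Arc i u v

    _⟶?_ : ∀ u v → Dec (u ⟶ v)
    u ⟶? v = any? λ i → Arc? i u v

    -- The direction is opposite to that of the arcs: a vertex has few in-arcs, so it is the
    -- out-arcs that have to supply a large in-degree. Leaving out pairs with arcs both ways makes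
    -- the relation asymmetric.
    Beats : Fin n → Fin n → Set
    Beats u v = ¬ (u ⟶ v) × v ⟶ u

    Beats? : ∀ u v → Dec (Beats u v)
    Beats? u v = ¬? (u ⟶? v) ×-dec v ⟶? u

    Apart : Fin n → Fin n → Set
    Apart u v = u ≢ v × ¬ (u ⟶ v) × ¬ (v ⟶ u)

    Apart? : ∀ u v → Dec (Apart u v)
    Apart? u v = ¬? (u ≟ v) ×-dec ¬? (u ⟶? v) ×-dec ¬? (v ⟶? u)

    Exc : Fin n → Fin n → Fin n → Set
    Exc u v w = Exceptional (col u v w) u v w

    Exc? : ∀ u v w → Dec (Exc u v w)
    Exc? u v w = Exceptional? (col u v w) u v w

    -- Each pair carries arcs in one direction only, and these run round the triangle, so there is
    -- no mutual pair and no vertex sends arcs to both others.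
    beats-triangle : ∀ {u v w} → Beats u v → Beats v w → Beats w u → Exc u v w
    beats-triangle {u} {v} {w} (¬uv , i , v→u) (¬vw , j , w→v) (¬wu , l , u→w)
      with classify (edge (≢-sym (Heavy-irrefl (pair v→u))) (≢-sym (Heavy-irrefl (pair w→v)))
                          (Heavy-irrefl (pair u→w)) refl)
    ... | inj₁ x = x
    ... | inj₂ (star₁ (a , _)) = contradiction (_ , a) ¬uv
    ... | inj₂ (star₂ (a , _)) = contradiction (_ , a) ¬vw
    ... | inj₂ (star₃ (a , _)) = contradiction (_ , a) ¬wu
    ... | inj₂ (mutual₁₂ (a , _)) = contradiction (_ , a) ¬uv
    ... | inj₂ (mutual₂₃ (a , _)) = contradiction (_ , a) ¬vw
    ... | inj₂ (mutual₃₁ (a , _)) = contradiction (_ , a) ¬wu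

    sum-colours : {R : Fin k → Fin n → Set} (R? : ∀ i u → Dec (R i u)) →
                  (∀ i x y → R i x → R i y → x ≡ y) → sum (λ u → sum λ i → 𝟙 (R? i u)) ≤ k
    sum-colours R? unique = begin
      sum (λ u → sum λ i → 𝟙 (R? i u)) ≡⟨ ∑-comm (λ u i → 𝟙 (R? i u)) ⟩
      sum (λ i → sum λ u → 𝟙 (R? i u)) ≤⟨ sum-≤-const (λ i → count-unique (R? i) (unique i)) ⟩
      k * 1                            ≡⟨ *-identityʳ k ⟩
      k                                ∎
      where open ≤-Reasoning

    -- A vertex other than `v` sends an arc to `v`, at most one per colour, or beats `v`, or is
    -- apart from it.
    degree-bound : ∀ v → n ≤ k + sum (λ u → 𝟙 (Beats? u v)) + sum (λ u → 𝟙 (Apart? u v)) + 1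
    degree-bound v = begin
      n      ≤⟨ size≤sum split ⟩
      sum (λ u → a u + b u + c u + d u)   ≡⟨ ∑-distrib-+ (λ u → a u + b u + c u) d ⟩
      sum (λ u → a u + b u + c u) + sum d ≡⟨ cong (_+ sum d) (sum-+₃ a b c) ⟩
      sum a + sum b + sum c + sum d       ≤⟨ +-mono-≤ (+-monoˡ-≤ (sum c) (+-monoˡ-≤ (sum b) arcs)) (sum-≡ v) ⟩
      k + sum b + sum c + 1               ∎
      where
      open ≤-Reasoning
      a b c d : Fin n → ℕ
      a u = sum λ i → 𝟙 (Arc? i u v)
      b u = 𝟙 (Beats? u v)
      c u = 𝟙 (Apart? u v)
      d u = 𝟙 (u ≟ v)
      arcs : sum a ≤ k
      arcs = sum-colours (λ i u → Arc? i u v) λ i x y p q → only q x (pair p)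
      split : ∀ u → 1 ≤ a u + b u + c u + d u
      split u = cases (u ≟ v) (u ⟶? v) (v ⟶? u)
        where
        cases : Dec (u ≡ v) → Dec (u ⟶ v) → Dec (v ⟶ u) → 1 ≤ a u + b u + c u + d u
        cases (yes u≡v) _ _ = ≤-trans (1≤𝟙 (u ≟ v) u≡v) (m≤n+m _ _)
        cases (no _) (yes (i , u→v)) _ =
          ≤-trans (≤-trans (1≤𝟙 (Arc? i u v) u→v) (term≤sum (λ i → 𝟙 (Arc? i u v)) i))
                  (≤-trans (m≤m+n _ _) (≤-trans (m≤m+n _ _) (m≤m+n _ _)))
        cases (no _) (no ¬uv) (yes vu) = ≤-trans (1≤𝟙 (Beats? u v) (¬uv , vu))
          (≤-trans (m≤n+m _ (a u)) (≤-trans (m≤m+n _ _) (m≤m+n _ _)))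
        cases (no ≢) (no ¬uv) (no ¬vu) = ≤-trans (1≤𝟙 (Apart? u v) (≢ , ¬uv , ¬vu))
          (≤-trans (m≤n+m _ (a u + b u)) (m≤m+n _ _))

    -- Each colour has at most one unexceptional edge `uvw`. With no arc between `u` and `v`,
    -- usefulness means that `w` sends arcs to both or is mutual with one of them. Two such `w` in
    -- one colour send arcs to a common vertex, which has only one in-arc, unless one is mutual with
    -- `u` and the other with `v`; then an edge is crossed, hence exceptional.
    apart-bound : ∀ {u v} → Apart u v → n ≤ k + 2 + sum (λ w → 𝟙 (Exc? u v w))
    apart-bound {u} {v} (u≢v , ¬uv , ¬vu) = begin
      n      ≤⟨ size≤sum split ⟩
      sum (λ w → a w + b w + c w)   ≡⟨ sum-+₃ a b c ⟩
      sum a + sum b + sum c         ≤⟨ +-monoˡ-≤ (sum c) (+-mono-≤ (sum-colours Fine? unique) (sum-∈ (u ∷ v ∷ []))) ⟩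
      k + 2 + sum c                 ∎
      where
      open ≤-Reasoning
      open DecMembership (_≟_ {n}) using (_∈?_)
      Fine : Fin k → Fin n → Set
      Fine i w = Edge i u v w × ¬ Exceptional i u v w
      Fine? : ∀ i w → Dec (Fine i w)
      Fine? i w = Edge? i u v w ×-dec ¬? (Exceptional? i u v w)
      a b c : Fin n → ℕ
      a w = sum λ i → 𝟙 (Fine? i w)
      b w = 𝟙 (w ∈? (u ∷ v ∷ []))
      c w = 𝟙 (Exc? u v w)

      split : ∀ w → 1 ≤ a w + b w + c w
      split w = cases (w ∈? (u ∷ v ∷ [])) (Exc? u v w)
        where
        cases : Dec (w ∈ u ∷ v ∷ []) → Dec (Exc u v w) → 1 ≤ a w + b w + c w
        cases (yes p) _ = ≤-trans (1≤𝟙 (w ∈? (u ∷ v ∷ [])) p)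
                            (≤-trans (m≤n+m _ (a w)) (m≤m+n _ _))
        cases (no _) (yes p) = ≤-trans (1≤𝟙 (Exc? u v w) p) (m≤n+m _ _)
        cases (no ∉) (no ¬p) = ≤-trans (≤-trans (1≤𝟙 (Fine? _ w) (e , ¬p))
                                 (term≤sum (λ i → 𝟙 (Fine? i w)) (col u v w)))
                                 (≤-trans (m≤m+n _ _) (m≤m+n _ _))
          where
          e : Edge (col u v w) u v w
          e = edge u≢v (λ v≡w → ∉ (there (here (sym v≡w)))) (λ u≡w → ∉ (here (sym u≡w))) refl

      data Link (i : Fin k) (w : Fin n) : Set where
        both  : Star i w u v → Link i w
        left  : Mutual i u w → Link i w
        right : Mutual i v w → Link i w

      link : ∀ {i w} → Useful i u v w → Link i w
      link (star₁ (a , _))    = contradiction (_ , a) ¬uv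
      link (star₂ (_ , a))    = contradiction (_ , a) ¬vu
      link (star₃ s)          = both s
      link (mutual₁₂ (a , _)) = contradiction (_ , a) ¬uv
      link (mutual₂₃ m)       = right m
      link (mutual₃₁ (a , b)) = left (b , a)

      crossing : ∀ {i x y} → Edge i u v x → Edge i u v y → Mutual i u x → Mutual i v y →
                 ¬ Exceptional i u v x → x ≡ y
      crossing {x = x} {y} uvx uvy (u→x , x→u) m ¬p with x ≟ y
      ... | yes x≡y = x≡y
      ... | no x≢y = contradiction
              (charged₂ (crossed (rotate uvx , (x→u , u→x) , y , uvy , ≢-sym x≢y , m))) ¬p

      unique : ∀ i x y → Fine i x → Fine i y → x ≡ y
      unique i x y (uvx , ¬p) (uvy , ¬q) with classify uvx | classify uvy
      ... | inj₁ p  | _      = contradiction p ¬p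
      ... | inj₂ _  | inj₁ q = contradiction q ¬q
      ... | inj₂ us | inj₂ us′ = go (link us) (link us′)
        where
        same : ∀ {t} → Arc i x t → Arc i y t → x ≡ y
        same p q = only q x (pair p)
        go : Link i x → Link i y → x ≡ y
        go (both (p , _))  (both (q , _))  = same p q
        go (both (p , _))  (left (_ , q))  = same p q
        go (both (_ , p))  (right (_ , q)) = same p q
        go (left (_ , p))  (both (q , _))  = same p q
        go (left (_ , p))  (left (_ , q))  = same p q
        go (left m)        (right m′)      = crossing uvx uvy m m′ ¬p
        go (right (_ , p)) (both (_ , q))  = same p q
        go (right m)       (left m′)       = sym (crossing uvy uvx m′ m ¬q)
        go (right (_ , p)) (right (_ , q)) = same p q

    -- 240 = 3 · 80: an exceptional triple is charged to one of its three vertices, and a vertex is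
    -- charged for at most 80 pairs per colour.
    Exc-count : sum (λ u → sum λ v → sum λ w → 𝟙 (Exc? u v w)) ≤ 240 * (n * k)
    Exc-count = begin
      sum (λ u → sum λ v → sum λ w → 𝟙 (Exc? u v w))
        ≤⟨ sum-mono (λ u → sum-mono λ v → sum-mono λ w → split u v w) ⟩
      sum (λ u → sum λ v → sum λ w → c u v w + c v w u + c w u v)
        ≡⟨ sum-cong-≗ (λ u → trans (sum₂-+ (λ v w → c u v w + c v w u) (λ v w → c w u v))
                                   (cong (_+ sum (λ v → sum λ w → c w u v)) (sum₂-+ (c u) (λ v w → c v w u)))) ⟩
      sum (λ u → sum (λ v → sum (λ w → c u v w)) + sum (λ v → sum (λ w → c v w u)) + sum (λ v → sum (λ w → c w u v)))
        ≡⟨ sum-+₃ (λ u → sum (λ v → sum (λ w → c u v w))) _ _ ⟩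
      C + sum (λ u → sum (λ v → sum (λ w → c v w u))) + sum (λ u → sum (λ v → sum (λ w → c w u v)))
        ≡⟨ cong₂ (λ s t → C + s + t)
             (trans (∑-comm λ u v → sum (λ w → c v w u)) (sum-cong-≗ λ v → ∑-comm λ u w → c v w u))
             (trans (sum-cong-≗ λ u → ∑-comm λ v w → c w u v) (∑-comm λ u w → sum (λ v → c w u v))) ⟩
      C + C + C            ≤⟨ +-mono-≤ (+-mono-≤ C≤ C≤) C≤ ⟩
      X + X + X            ≡⟨ solve 2 (λ n k → let x = n :* (k :* con 80) in x :+ x :+ x := con 240 :* (n :* k)) refl n k ⟩
      240 * (n * k)        ∎
      where
      open ≤-Reasoning
      X = n * (k * 80)
      c : Fin n → Fin n → Fin n → ℕ
      c u v w = sum λ i → 𝟙 (Charged? i u v w)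
      C = sum λ u → sum λ v → sum λ w → c u v w

      C≤ : C ≤ X
      C≤ = sum-≤-const λ u → begin
        sum (λ v → sum λ w → sum λ i → 𝟙 (Charged? i u v w))
          ≡⟨ sum-cong-≗ (λ v → ∑-comm λ w i → 𝟙 (Charged? i u v w)) ⟩
        sum (λ v → sum λ i → sum λ w → 𝟙 (Charged? i u v w))
          ≡⟨ ∑-comm (λ v i → sum λ w → 𝟙 (Charged? i u v w)) ⟩
        sum (λ i → count₂ (Charged? i u))
          ≤⟨ sum-≤-const (λ i → Charged-count i u) ⟩
        k * 80 ∎

      split : ∀ u v w → 𝟙 (Exc? u v w) ≤ c u v w + c v w u + c w u v
      split u v w = 𝟙-≤ (Exc? u v w) λ
        { (charged₁ p) → ≤-trans (one p) (≤-trans (m≤m+n _ _) (m≤m+n _ _))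
        ; (charged₂ p) → ≤-trans (one p) (≤-trans (m≤n+m _ (c u v w)) (m≤m+n _ _))
        ; (charged₃ p) → ≤-trans (one p) (m≤n+m _ _) }
        where
        one : ∀ {i x y z} → Charged i x y z → 1 ≤ c x y z
        one {i} {x} {y} {z} p = ≤-trans (1≤𝟙 (Charged? i x y z) p)
                                  (term≤sum (λ i → 𝟙 (Charged? i x y z)) i)

  -- Random samples

  total : {A : Set} → (A → ℕ) → List A → ℕ
  total g xs = ListAction.sum (map g xs)

  totalPairs : {A : Set} → (A → A → ℕ) → List A → ℕ
  totalPairs g []       = 0
  totalPairs g (x ∷ xs) = total (g x) xs + totalPairs g xs

  totalTriples : {A : Set} → (A → A → A → ℕ) → List A → ℕ
  totalTriples g []       = 0
  totalTriples g (x ∷ xs) = totalPairs (g x) xs + totalTriples g xs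

  module _ {A : Set} where

    term≤total : (g : A → ℕ) (xs : List A) → ∀ i → g (lookup xs i) ≤ total g xs
    term≤total g (x ∷ xs) zero    = m≤m+n _ _
    term≤total g (x ∷ xs) (suc i) = ≤-trans (term≤total g xs i) (m≤n+m _ _)

    term≤totalPairs : (g : A → A → ℕ) (xs : List A) → ∀ {i j} → i Fin.< j →
                      g (lookup xs i) (lookup xs j) ≤ totalPairs g xs
    term≤totalPairs g (x ∷ xs) {zero}  {suc j} _       = ≤-trans (term≤total (g x) xs j) (m≤m+n _ _)
    term≤totalPairs g (x ∷ xs) {suc i} {suc j} (s≤s h) = ≤-trans (term≤totalPairs g xs h) (m≤n+m _ _)

    term≤totalTriples : (g : A → A → A → ℕ) (xs : List A) → ∀ {i j l} → i Fin.< j → j Fin.< l →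
                        g (lookup xs i) (lookup xs j) (lookup xs l) ≤ totalTriples g xs
    term≤totalTriples g (x ∷ xs) {zero}  {suc j} {suc l} _ (s≤s h) =
      ≤-trans (term≤totalPairs (g x) xs h) (m≤m+n _ _)
    term≤totalTriples g (x ∷ xs) {suc i} {suc j} {suc l} (s≤s h) (s≤s h′) =
      ≤-trans (term≤totalTriples g xs h h′) (m≤n+m _ _)

    total-mono : {g h : A → ℕ} (xs : List A) → (∀ x → g x ≤ h x) → total g xs ≤ total h xs
    total-mono []       g≤h = z≤n
    total-mono (x ∷ xs) g≤h = +-mono-≤ (g≤h x) (total-mono xs g≤h)

    module _ {P : A → Set} (P? : ∀ x → Dec (P x)) where

      total-filter : (g : A → ℕ) (xs : List A) → total g (filter P? xs) ≤ total g xs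
      total-filter g []       = z≤n
      total-filter g (x ∷ xs) with P? x
      ... | yes _ = +-monoʳ-≤ (g x) (total-filter g xs)
      ... | no _  = ≤-trans (total-filter g xs) (m≤n+m _ _)

      totalPairs-filter : (g : A → A → ℕ) (xs : List A) → totalPairs g (filter P? xs) ≤ totalPairs g xs
      totalPairs-filter g []       = z≤n
      totalPairs-filter g (x ∷ xs) with P? x
      ... | yes _ = +-mono-≤ (total-filter (g x) xs) (totalPairs-filter g xs)
      ... | no _  = ≤-trans (totalPairs-filter g xs) (m≤n+m _ _)

      totalTriples-filter : (g : A → A → A → ℕ) (xs : List A) →
                            totalTriples g (filter P? xs) ≤ totalTriples g xs
      totalTriples-filter g []       = z≤n
      totalTriples-filter g (x ∷ xs) with P? x
      ... | yes _ = +-mono-≤ (totalPairs-filter (g x) xs) (totalTriples-filter g xs)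
      ... | no _  = ≤-trans (totalTriples-filter g xs) (m≤n+m _ _)

      filter-loss : (g : A → ℕ) → (∀ x → g x ≤ 1) → (xs : List A) →
                    total g xs ≤ total g (filter P? xs) + total (λ x → 𝟙 (¬? (P? x))) xs
      filter-loss g g≤1 []       = z≤n
      filter-loss g g≤1 (x ∷ xs) with P? x
      ... | yes _ = ≤-trans (+-monoʳ-≤ (g x) (filter-loss g g≤1 xs)) (≤-reflexive (sym (+-assoc (g x) _ _)))
      ... | no _  = ≤-trans (+-mono-≤ (g≤1 x) (filter-loss g g≤1 xs)) (≤-reflexive (sym (+-suc _ _)))

    length≡total : (xs : List A) → length xs ≡ total (λ _ → 1) xs
    length≡total []       = refl
    length≡total (x ∷ xs) = cong suc (length≡total xs)

    total-toList : (g : A → ℕ) {m : ℕ} (xs : Vec A m) →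
                   total g (Vec.toList xs) ≡ sum (λ i → g (Vec.lookup xs i))
    total-toList g []       = refl
    total-toList g (x ∷ xs) = cong (g x +_) (total-toList g xs)

    total-insertAt : (g : A → ℕ) {m : ℕ} (xs : Vec A m) (i : Fin (suc m)) (v : A) →
                     total g (Vec.toList xs) ≤ total g (Vec.toList (Vec.insertAt xs i v))
    total-insertAt g xs       zero    v = m≤n+m _ _
    total-insertAt g (x ∷ xs) (suc i) v = +-monoʳ-≤ (g x) (total-insertAt g xs i v)

  -- This is d² ≤ (b - a)² with the mixed term moved across.
  square-gap : ∀ a b d → a + d ≤ b → d * d + 2 * a * b ≤ a * a + b * b
  square-gap a b d h with m≤n⇒∃[o]m+o≡n h
  ... | t , refl = ≤-trans (m≤m+n _ (2 * d * t + t * t)) (≤-reflexive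
    (solve 3 (λ a d t → d :* d :+ con 2 :* a :* (a :+ d :+ t) :+ (con 2 :* d :* t :+ t :* t) :=
                        a :* a :+ (a :+ d :+ t) :* (a :+ d :+ t)) refl a d t))

  square-mean : ∀ a b → 2 * a * b ≤ a * a + b * b
  square-mean a b with ≤-total a b
  ... | inj₁ a≤b = square-gap a b 0 (subst (_≤ b) (sym (+-identityʳ a)) a≤b)
  ... | inj₂ b≤a = subst₂ _≤_ (solve 2 (λ a b → con 2 :* b :* a := con 2 :* a :* b) refl a b) (+-comm (b * b) (a * a))
                     (square-gap b a 0 (subst (_≤ a) (sym (+-identityʳ b)) b≤a))

  module Sampling (n : ℕ) where

    -- This is `n ^ m` times the expectation over `m` independent uniform vertices, drawn with
    -- replacement. All moments are stated free of denominators.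
    ∑ⱽ : (m : ℕ) → (Vec (Fin n) m → ℕ) → ℕ
    ∑ⱽ zero    Φ = Φ []
    ∑ⱽ (suc m) Φ = sum λ x → ∑ⱽ m λ xs → Φ (x ∷ xs)

    ∑ⱽ-mono : ∀ m {Φ Ψ} → (∀ xs → Φ xs ≤ Ψ xs) → ∑ⱽ m Φ ≤ ∑ⱽ m Ψ
    ∑ⱽ-mono zero    h = h []
    ∑ⱽ-mono (suc m) h = sum-mono λ x → ∑ⱽ-mono m λ xs → h (x ∷ xs)

    ∑ⱽ-cong : ∀ m {Φ Ψ} → (∀ xs → Φ xs ≡ Ψ xs) → ∑ⱽ m Φ ≡ ∑ⱽ m Ψ
    ∑ⱽ-cong m h = ≤-antisym (∑ⱽ-mono m λ xs → ≤-reflexive (h xs)) (∑ⱽ-mono m λ xs → ≤-reflexive (sym (h xs)))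

    ∑ⱽ-+ : ∀ m Φ Ψ → ∑ⱽ m (λ xs → Φ xs + Ψ xs) ≡ ∑ⱽ m Φ + ∑ⱽ m Ψ
    ∑ⱽ-+ zero    Φ Ψ = refl
    ∑ⱽ-+ (suc m) Φ Ψ = trans (sum-cong-≗ λ x → ∑ⱽ-+ m (λ xs → Φ (x ∷ xs)) (λ xs → Ψ (x ∷ xs)))
                             (∑-distrib-+ (λ x → ∑ⱽ m λ xs → Φ (x ∷ xs)) _)

    ∑ⱽ-* : ∀ m c Φ → ∑ⱽ m (λ xs → c * Φ xs) ≡ c * ∑ⱽ m Φ
    ∑ⱽ-* zero    c Φ = refl
    ∑ⱽ-* (suc m) c Φ = trans (sum-cong-≗ λ x → ∑ⱽ-* m c (λ xs → Φ (x ∷ xs)))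
                             (sym (*-distribˡ-sum c λ x → ∑ⱽ m λ xs → Φ (x ∷ xs)))

    ∑ⱽ-const : ∀ m c → ∑ⱽ m (λ _ → c) ≡ n ^ m * c
    ∑ⱽ-const zero    c = sym (+-identityʳ c)
    ∑ⱽ-const (suc m) c = trans (sum-cong-≗ {n} λ x → ∑ⱽ-const m c)
                               (trans (sum-const n _) (sym (*-assoc n (n ^ m) c)))

    ∑ⱽ-sum : ∀ m {l} (Φ : Fin l → Vec (Fin n) m → ℕ) →
             ∑ⱽ m (λ xs → sum λ i → Φ i xs) ≡ sum λ i → ∑ⱽ m (Φ i)
    ∑ⱽ-sum zero    Φ = refl
    ∑ⱽ-sum (suc m) Φ = trans (sum-cong-≗ λ x → ∑ⱽ-sum m λ i xs → Φ i (x ∷ xs))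
                             (∑-comm λ x i → ∑ⱽ m λ xs → Φ i (x ∷ xs))

    -- Conditioning on the entry at position `i`: the remaining entries are again an independent
    -- sample.
    ∑ⱽ-insertAt : ∀ m Φ (i : Fin (suc m)) →
                  ∑ⱽ (suc m) Φ ≡ sum λ v → ∑ⱽ m λ xs → Φ (Vec.insertAt xs i v)
    ∑ⱽ-insertAt m       Φ zero    = refl
    ∑ⱽ-insertAt (suc m) Φ (suc i) = trans (sum-cong-≗ λ x → ∑ⱽ-insertAt m (λ xs → Φ (x ∷ xs)) i)
      (∑-comm λ x v → ∑ⱽ m λ xs → Φ (x ∷ Vec.insertAt xs i v))

    -- The entries are fixed one at a time, each so that the mean over the remaining ones stays
    -- below `c`.
    ∑ⱽ-witness : ∀ m {c} Φ → ∑ⱽ m Φ < n ^ m * c → ∃ λ xs → Φ xs < c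
    ∑ⱽ-witness zero    {c} Φ h = [] , subst (Φ [] <_) (+-identityʳ c) h
    ∑ⱽ-witness (suc m) {c} Φ h =
      let x , hx   = sum-<-witness (λ x → ∑ⱽ m λ xs → Φ (x ∷ xs)) (subst (∑ⱽ (suc m) Φ <_) (*-assoc n (n ^ m) c) h)
          xs , hxs = ∑ⱽ-witness m (λ xs → Φ (x ∷ xs)) hx
      in x ∷ xs , hxs


    module _ (g : Fin n → ℕ) where

      private
        G = sum g
        T : ∀ {m} → Vec (Fin n) m → ℕ
        T xs = total g (Vec.toList xs)
        S₁ S₂ : ℕ → ℕ
        S₁ m = ∑ⱽ m T
        S₂ m = ∑ⱽ m λ xs → T xs * T xs

      S₁-suc : ∀ m → S₁ (suc m) ≡ n ^ m * G + n * S₁ m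
      S₁-suc m = begin
        sum (λ x → ∑ⱽ m λ xs → g x + T xs)   ≡⟨ sum-cong-≗ (λ x → trans (∑ⱽ-+ m (λ _ → g x) T) (cong (_+ S₁ m) (∑ⱽ-const m (g x)))) ⟩
        sum (λ x → n ^ m * g x + S₁ m)       ≡⟨ ∑-distrib-+ (λ x → n ^ m * g x) _ ⟩
        sum (λ x → n ^ m * g x) + sum {n} (λ _ → S₁ m) ≡⟨ cong₂ _+_ (sym (*-distribˡ-sum (n ^ m) g)) (sum-const n (S₁ m)) ⟩
        n ^ m * G + n * S₁ m                 ∎
        where open ≡-Reasoning

      first-moment : ∀ m → n * S₁ m ≡ m * (n ^ m * G)
      first-moment zero    = *-zeroʳ n
      first-moment (suc m) = begin
        n * S₁ (suc m)                      ≡⟨ cong (n *_) (S₁-suc m) ⟩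
        n * (n ^ m * G + n * S₁ m)          ≡⟨ cong (λ s → n * (n ^ m * G + s)) (first-moment m) ⟩
        n * (n ^ m * G + m * (n ^ m * G))
          ≡⟨ solve 4 (λ n m N G → n :* (N :* G :+ m :* (N :* G)) := (con 1 :+ m) :* (n :* N :* G)) refl n m (n ^ m) G ⟩
        suc m * (n ^ suc m * G)             ∎
        where open ≡-Reasoning

      module _ (g-idem : ∀ x → g x * g x ≡ g x) where

        S₂-suc : ∀ m → S₂ (suc m) ≡ n ^ m * G + 2 * (G * S₁ m) + n * S₂ m
        S₂-suc m = begin
          sum (λ x → ∑ⱽ m λ xs → (g x + T xs) * (g x + T xs))
            ≡⟨ sum-cong-≗ (λ x → trans (∑ⱽ-cong m (square x)) (terms x)) ⟩
          sum (λ x → n ^ m * g x + 2 * S₁ m * g x + S₂ m)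
            ≡⟨ sum-+₃ (λ x → n ^ m * g x) (λ x → 2 * S₁ m * g x) (λ _ → S₂ m) ⟩
          sum (λ x → n ^ m * g x) + sum (λ x → 2 * S₁ m * g x) + sum {n} (λ _ → S₂ m)
            ≡⟨ cong₂ _+_ (cong₂ _+_ (sym (*-distribˡ-sum (n ^ m) g)) (sym (*-distribˡ-sum (2 * S₁ m) g))) (sum-const n (S₂ m)) ⟩
          n ^ m * G + 2 * S₁ m * G + n * S₂ m
            ≡⟨ cong (λ s → n ^ m * G + s + n * S₂ m) (trans (*-assoc 2 (S₁ m) G) (cong (2 *_) (*-comm (S₁ m) G))) ⟩
          n ^ m * G + 2 * (G * S₁ m) + n * S₂ m ∎
          where
          open ≡-Reasoning
          square : ∀ x (xs : Vec (Fin n) m) → (g x + T xs) * (g x + T xs) ≡ g x + 2 * g x * T xs + T xs * T xs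
          square x xs = trans (solve 2 (λ a t → (a :+ t) :* (a :+ t) := a :* a :+ con 2 :* a :* t :+ t :* t) refl (g x) (T xs))
                              (cong (λ s → s + 2 * g x * T xs + T xs * T xs) (g-idem x))
          terms : ∀ x → ∑ⱽ m (λ xs → g x + 2 * g x * T xs + T xs * T xs) ≡ n ^ m * g x + 2 * S₁ m * g x + S₂ m
          terms x = trans (∑ⱽ-+ m (λ xs → g x + 2 * g x * T xs) (λ xs → T xs * T xs)) (cong (_+ S₂ m)
            (trans (∑ⱽ-+ m (λ _ → g x) (λ xs → 2 * g x * T xs)) (cong₂ _+_ (∑ⱽ-const m (g x))
              (trans (∑ⱽ-* m (2 * g x) T) (solve 2 (λ a s → con 2 :* a :* s := con 2 :* s :* a) refl (g x) (S₁ m))))))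

        -- The variance formula, with both sides moved so that no subtraction occurs.
        second-moment : ∀ m → n * n * S₂ m + m * (G * G * n ^ m) ≡ m * m * (G * G * n ^ m) + m * (n * (G * n ^ m))
        second-moment zero    = trans (+-identityʳ _) (*-zeroʳ (n * n))
        second-moment (suc m) = begin
          n * n * S₂ (suc m) + suc m * (G * G * (n * N))
            ≡⟨ cong (λ s → n * n * s + suc m * (G * G * (n * N))) (S₂-suc m) ⟩
          n * n * (N * G + 2 * (G * S₁ m) + n * S₂ m) + suc m * (G * G * (n * N))
            ≡⟨ solve 6 (λ n m N G s₁ s₂ →
                 n :* n :* (N :* G :+ con 2 :* (G :* s₁) :+ n :* s₂) :+ (con 1 :+ m) :* (G :* G :* (n :* N)) :=
                 n :* n :* (N :* G) :+ con 2 :* n :* G :* (n :* s₁) :+ n :* (n :* n :* s₂ :+ m :* (G :* G :* N)) :+ n :* (G :* G :* N))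
                 refl n m N G (S₁ m) (S₂ m) ⟩
          n * n * (N * G) + 2 * n * G * (n * S₁ m) + n * (n * n * S₂ m + m * (G * G * N)) + n * (G * G * N)
            ≡⟨ cong₂ (λ s t → n * n * (N * G) + 2 * n * G * s + n * t + n * (G * G * N)) (first-moment m) (second-moment m) ⟩
          n * n * (N * G) + 2 * n * G * (m * (N * G)) + n * (m * m * (G * G * N) + m * (n * (G * N))) + n * (G * G * N)
            ≡⟨ solve 4 (λ n m N G →
                 n :* n :* (N :* G) :+ con 2 :* n :* G :* (m :* (N :* G))
                   :+ n :* (m :* m :* (G :* G :* N) :+ m :* (n :* (G :* N))) :+ n :* (G :* G :* N) :=
                 (con 1 :+ m) :* (con 1 :+ m) :* (G :* G :* (n :* N)) :+ (con 1 :+ m) :* (n :* (G :* (n :* N))))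
                 refl n m N G ⟩
          suc m * suc m * (G * G * (n * N)) + suc m * (n * (G * (n * N))) ∎
          where
          open ≡-Reasoning
          N = n ^ m

    -- At most m² pairs of positions contribute, each with the average of `g` as its mean; the crude
    -- m² replaces the binomial coefficient.
    pairs-moment : ∀ m (g : Fin n → Fin n → ℕ) →
      n * n * ∑ⱽ m (λ xs → totalPairs g (Vec.toList xs)) ≤ m * m * (n ^ m * sum λ x → sum (g x))
    pairs-moment zero    g = ≤-reflexive (*-zeroʳ (n * n))
    pairs-moment (suc m) g = begin
      n * n * sum (λ x → ∑ⱽ m λ xs → total (g x) (Vec.toList xs) + totalPairs g (Vec.toList xs))
        ≡⟨ cong (n * n *_)
             (trans (sum-cong-≗ λ x → ∑ⱽ-+ m (λ xs → total (g x) (Vec.toList xs)) (λ xs → totalPairs g (Vec.toList xs)))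
             (trans (∑-distrib-+ (λ x → ∑ⱽ m λ xs → total (g x) (Vec.toList xs)) _) (cong (A +_) (sum-const n P)))) ⟩
      n * n * (A + n * P)
        ≡⟨ solve 3 (λ n a p → n :* n :* (a :+ n :* p) := n :* (n :* a) :+ n :* (n :* n :* p)) refl n A P ⟩
      n * (n * A) + n * (n * n * P)
        ≤⟨ +-mono-≤ (*-monoʳ-≤ n (≤-reflexive nA)) (*-monoʳ-≤ n (pairs-moment m g)) ⟩
      n * (m * N * G) + n * (m * m * (N * G))
        ≤⟨ m≤m+n _ (suc m * (n * N * G)) ⟩
      n * (m * N * G) + n * (m * m * (N * G)) + suc m * (n * N * G)
        ≡⟨ solve 4 (λ n m N G → n :* (m :* N :* G) :+ n :* (m :* m :* (N :* G)) :+ (con 1 :+ m) :* (n :* N :* G)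
             := (con 1 :+ m) :* (con 1 :+ m) :* (n :* N :* G)) refl n m N G ⟩
      suc m * suc m * (n ^ suc m * G) ∎
      where
      open ≤-Reasoning
      N = n ^ m
      G = sum λ x → sum (g x)
      A = sum λ x → ∑ⱽ m λ xs → total (g x) (Vec.toList xs)
      P = ∑ⱽ m λ xs → totalPairs g (Vec.toList xs)
      nA : n * A ≡ m * N * G
      nA = trans (*-distribˡ-sum n λ x → ∑ⱽ m λ xs → total (g x) (Vec.toList xs))
          (trans (sum-cong-≗ λ x → trans (first-moment (g x) m) (sym (*-assoc m N (sum (g x)))))
                 (sym (*-distribˡ-sum (m * N) λ x → sum (g x))))

    triples-moment : ∀ m (g : Fin n → Fin n → Fin n → ℕ) →
      n * n * n * ∑ⱽ m (λ xs → totalTriples g (Vec.toList xs)) ≤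
      m * m * m * (n ^ m * sum λ x → sum λ y → sum (g x y))
    triples-moment zero    g = ≤-reflexive (*-zeroʳ (n * n * n))
    triples-moment (suc m) g = begin
      n * n * n * sum (λ x → ∑ⱽ m λ xs → totalPairs (g x) (Vec.toList xs) + totalTriples g (Vec.toList xs))
        ≡⟨ cong (n * n * n *_)
             (trans (sum-cong-≗ λ x → ∑ⱽ-+ m (λ xs → totalPairs (g x) (Vec.toList xs)) (λ xs → totalTriples g (Vec.toList xs)))
             (trans (∑-distrib-+ (λ x → ∑ⱽ m λ xs → totalPairs (g x) (Vec.toList xs)) _) (cong (A +_) (sum-const n P)))) ⟩
      n * n * n * (A + n * P)
        ≡⟨ solve 3 (λ n a p → n :* n :* n :* (a :+ n :* p) := n :* (n :* n :* a) :+ n :* (n :* n :* n :* p)) refl n A P ⟩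
      n * (n * n * A) + n * (n * n * n * P)
        ≤⟨ +-mono-≤ (*-monoʳ-≤ n nnA) (*-monoʳ-≤ n (triples-moment m g)) ⟩
      n * (m * m * N * G) + n * (m * m * m * (N * G))
        ≤⟨ m≤m+n _ ((suc m * suc m + m * suc m) * (n * N * G)) ⟩
      n * (m * m * N * G) + n * (m * m * m * (N * G)) + (suc m * suc m + m * suc m) * (n * N * G)
        ≡⟨ solve 4 (λ n m N G → n :* (m :* m :* N :* G) :+ n :* (m :* m :* m :* (N :* G))
             :+ ((con 1 :+ m) :* (con 1 :+ m) :+ m :* (con 1 :+ m)) :* (n :* N :* G)
             := (con 1 :+ m) :* (con 1 :+ m) :* (con 1 :+ m) :* (n :* N :* G)) refl n m N G ⟩
      suc m * suc m * suc m * (n ^ suc m * G) ∎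
      where
      open ≤-Reasoning
      N = n ^ m
      G = sum λ x → sum λ y → sum (g x y)
      A = sum λ x → ∑ⱽ m λ xs → totalPairs (g x) (Vec.toList xs)
      P = ∑ⱽ m λ xs → totalTriples g (Vec.toList xs)
      nnA : n * n * A ≤ m * m * N * G
      nnA = begin
        n * n * A ≡⟨ *-distribˡ-sum (n * n) (λ x → ∑ⱽ m λ xs → totalPairs (g x) (Vec.toList xs)) ⟩
        sum (λ x → n * n * ∑ⱽ m λ xs → totalPairs (g x) (Vec.toList xs))
          ≤⟨ sum-mono (λ x → ≤-trans (pairs-moment m (g x)) (≤-reflexive (sym (*-assoc (m * m) N _)))) ⟩
        sum (λ x → m * m * N * sum λ y → sum (g x y)) ≡⟨ sym (*-distribˡ-sum (m * m * N) λ x → sum λ y → sum (g x y)) ⟩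
        m * m * N * G ∎

    module _ {P : Fin n → Set} (P? : ∀ x → Dec (P x)) (a Q : ℕ) where

      private
        g : Fin n → ℕ
        g x = 𝟙 (P? x)
        G = sum g

      -- By `rich`, Q times the total has mean at least (a + 2) m, so a sample below (a + 1) m
      -- deviates by at least m. The variance is at most Q² m, so this has probability at most Q² /
      -- m.
      chebyshev : ∀ m → 0 < n → 0 < m → (a + 2) * n ≤ Q * G →
                  m * ∑ⱽ m (λ xs → 𝟙 (Q * total g (Vec.toList xs) <? (a + 1) * m)) ≤ Q * Q * n ^ m
      chebyshev m 0<n 0<m rich =
        *-cancelʳ-≤ _ _ (m * n * n) ⦃ >-nonZero (*-mono-< (*-mono-< 0<m 0<n) 0<n) ⦄ (begin
          m * X * (m * n * n)
            ≡⟨ solve 3 (λ m n x → m :* x :* (m :* n :* n) := m :* n :* (m :* n) :* x) refl m n X ⟩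
          D * D * X
            -- `summed` carries on both sides the terms that the variance would subtract.
            ≤⟨ +-cancelʳ-≤ (2 * (N * (B * B)) + Q * Q * (m * (G * G * N))) _ _ summed ⟩
          Q * Q * (m * (n * (G * N)))
            ≤⟨ *-monoʳ-≤ (Q * Q) (*-monoʳ-≤ m (*-monoʳ-≤ n (*-monoˡ-≤ N G≤n))) ⟩
          Q * Q * (m * (n * (n * N)))
            ≡⟨ solve 4 (λ q m n N → q :* q :* (m :* (n :* (n :* N))) := q :* q :* N :* (m :* n :* n)) refl Q m n N ⟩
          Q * Q * N * (m * n * n) ∎)
        where
        open ≤-Reasoning
        N = n ^ m
        D = m * n
        B = m * (Q * G)
        T : Vec (Fin n) m → ℕ
        T xs = total g (Vec.toList xs)
        bad? : ∀ xs → Dec (Q * T xs < (a + 1) * m)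
        bad? xs = Q * T xs <? (a + 1) * m
        X = ∑ⱽ m λ xs → 𝟙 (bad? xs)
        S₁ = ∑ⱽ m T
        S₂ = ∑ⱽ m λ xs → T xs * T xs

        G≤n : G ≤ n
        G≤n = ≤-trans (sum-≤-const λ x → 𝟙≤1 (P? x)) (≤-reflexive (*-identityʳ n))

        -- On a bad sample (m n)² is at most (n Q T - B)², where B is n times the mean of Q T.
        pointwise : ∀ xs → D * D * 𝟙 (bad? xs) + 2 * n * Q * B * T xs ≤ n * Q * (n * Q) * (T xs * T xs) + B * B
        pointwise xs = begin
          D * D * 𝟙 (bad? xs) + 2 * n * Q * B * T xs
            ≡⟨ solve 5 (λ d n q b t → d :+ con 2 :* n :* q :* b :* t := d :+ con 2 :* (n :* (q :* t)) :* b)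
                 refl (D * D * 𝟙 (bad? xs)) n Q B (T xs) ⟩
          D * D * 𝟙 (bad? xs) + 2 * (n * (Q * T xs)) * B
            ≤⟨ cases (bad? xs) ⟩
          n * (Q * T xs) * (n * (Q * T xs)) + B * B
            ≡⟨ solve 4 (λ n q b t → n :* (q :* t) :* (n :* (q :* t)) :+ b :* b := n :* q :* (n :* q) :* (t :* t) :+ b :* b)
                 refl n Q B (T xs) ⟩
          n * Q * (n * Q) * (T xs * T xs) + B * B ∎
          where
          cases : (d : Dec (Q * T xs < (a + 1) * m)) →
                  D * D * 𝟙 d + 2 * (n * (Q * T xs)) * B ≤ n * (Q * T xs) * (n * (Q * T xs)) + B * B
          cases (yes low) = subst (λ e → e + 2 * (n * (Q * T xs)) * B ≤ n * (Q * T xs) * (n * (Q * T xs)) + B * B)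
            (sym (*-identityʳ (D * D))) (square-gap (n * (Q * T xs)) B D (begin
            n * (Q * T xs) + m * n       ≤⟨ +-monoˡ-≤ (m * n) (*-monoʳ-≤ n (<⇒≤ low)) ⟩
            n * ((a + 1) * m) + m * n
              ≡⟨ solve 3 (λ n a m → n :* ((a :+ con 1) :* m) :+ m :* n := m :* ((a :+ con 2) :* n)) refl n a m ⟩
            m * ((a + 2) * n)            ≤⟨ *-monoʳ-≤ m rich ⟩
            m * (Q * G)                  ∎))
          cases (no _) = subst (λ e → e + 2 * (n * (Q * T xs)) * B ≤ n * (Q * T xs) * (n * (Q * T xs)) + B * B)
            (sym (*-zeroʳ (D * D))) (square-mean (n * (Q * T xs)) B)

        averaged : D * D * X + 2 * n * Q * B * S₁ ≤ n * Q * (n * Q) * S₂ + N * (B * B)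
        averaged = begin
          D * D * X + 2 * n * Q * B * S₁
            ≡⟨ sym (trans (∑ⱽ-+ m (λ xs → D * D * 𝟙 (bad? xs)) (λ xs → 2 * n * Q * B * T xs))
                          (cong₂ _+_ (∑ⱽ-* m (D * D) (λ xs → 𝟙 (bad? xs))) (∑ⱽ-* m (2 * n * Q * B) T))) ⟩
          ∑ⱽ m (λ xs → D * D * 𝟙 (bad? xs) + 2 * n * Q * B * T xs)
            ≤⟨ ∑ⱽ-mono m pointwise ⟩
          ∑ⱽ m (λ xs → n * Q * (n * Q) * (T xs * T xs) + B * B)
            ≡⟨ trans (∑ⱽ-+ m (λ xs → n * Q * (n * Q) * (T xs * T xs)) (λ _ → B * B))
                     (cong₂ _+_ (∑ⱽ-* m (n * Q * (n * Q)) (λ xs → T xs * T xs)) (∑ⱽ-const m (B * B))) ⟩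
          n * Q * (n * Q) * S₂ + N * (B * B) ∎

        summed : D * D * X + (2 * (N * (B * B)) + Q * Q * (m * (G * G * N))) ≤
                 Q * Q * (m * (n * (G * N))) + (2 * (N * (B * B)) + Q * Q * (m * (G * G * N)))
        summed = begin
          D * D * X + (2 * (N * (B * B)) + R)
            ≡⟨ cong (λ s → D * D * X + (s + R)) (trans
                 (solve 4 (λ q m N G → con 2 :* (N :* (m :* (q :* G) :* (m :* (q :* G)))) :=
                    con 2 :* q :* (m :* (q :* G)) :* (m :* (N :* G))) refl Q m N G)
                 (trans (cong (2 * Q * B *_) (sym (first-moment g m)))
                   (solve 4 (λ n q b s → con 2 :* q :* b :* (n :* s) := con 2 :* n :* q :* b :* s) refl n Q B S₁))) ⟩
          D * D * X + (2 * n * Q * B * S₁ + R)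
            ≡⟨ sym (+-assoc (D * D * X) _ R) ⟩
          D * D * X + 2 * n * Q * B * S₁ + R
            ≤⟨ +-monoˡ-≤ R averaged ⟩
          n * Q * (n * Q) * S₂ + N * (B * B) + R
            ≡⟨ solve 6 (λ n q s m r b → n :* q :* (n :* q) :* s :+ b :+ q :* q :* (m :* r) :=
                  q :* q :* (n :* n :* s :+ m :* r) :+ b) refl n Q S₂ m (G * G * N) (N * (B * B)) ⟩
          Q * Q * (n * n * S₂ + m * (G * G * N)) + N * (B * B)
            ≡⟨ cong (λ s → Q * Q * s + N * (B * B)) (second-moment g (λ x → 𝟙-idem (P? x)) m) ⟩
          Q * Q * (m * m * (G * G * N) + m * (n * (G * N))) + N * (B * B)
            ≡⟨ solve 5 (λ n q m N G → q :* q :* (m :* m :* (G :* G :* N) :+ m :* (n :* (G :* N))) :+ N :* (m :* (q :* G) :* (m :* (q :* G)))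
                 := q :* q :* (m :* (n :* (G :* N))) :+ con 2 :* (N :* (m :* (q :* G) :* (m :* (q :* G))))) refl n Q m N G ⟩
          Q * Q * (m * (n * (G * N))) + 2 * (N * (B * B))
            ≤⟨ +-monoʳ-≤ (Q * Q * (m * (n * (G * N)))) (m≤m+n _ R) ⟩
          Q * Q * (m * (n * (G * N))) + (2 * (N * (B * B)) + R) ∎
          where R = Q * Q * (m * (G * G * N))

  -- Sampling in an oriented graph with few directed triangles

  small-multiple : ∀ {k} t → k * t < k → t ≡ 0
  small-multiple {k} zero    _ = refl
  small-multiple {k} (suc t) h = contradiction (m≤m*n k (suc t)) (<⇒≱ h)

  module Tournament {n : ℕ} {R : Fin n → Fin n → Set} (R? : ∀ u v → Dec (R u v))
                    (asym : ∀ {u v} → R u v → ¬ R v u) where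

    open Sampling n

    degree : Fin n → ℕ
    degree v = sum λ u → 𝟙 (R? u v)

    degreeIn : Fin n → List (Fin n) → ℕ
    degreeIn v = total λ u → 𝟙 (R? u v)

    Cyclic : Fin n → Fin n → Fin n → Set
    Cyclic u v w = R u v × R v w × R w u

    Cyclic? : ∀ u v w → Dec (Cyclic u v w)
    Cyclic? u v w = R? u v ×-dec R? v w ×-dec R? w u

    -- Triples of positions are listed in increasing order; a directed triangle, started at its
    -- smallest position, then appears in one of two orders.
    cyclic-orders : Fin n → Fin n → Fin n → ℕ
    cyclic-orders u v w = 𝟙 (Cyclic? u v w) + 𝟙 (Cyclic? u w v)

    module _ (a Q : ℕ) where

      -- Here a / Q stands for α. The surplus m / Q over α m pays for deletions from the sample, and
      -- `Poor` allows a further n / Q for the deviation of the sample.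
      Bad : ℕ → List (Fin n) → Fin n → Set
      Bad m xs v = Q * degreeIn v xs < (a + 1) * m

      Bad? : ∀ m xs v → Dec (Bad m xs v)
      Bad? m xs v = Q * degreeIn v xs <? (a + 1) * m

      badness : ℕ → List (Fin n) → ℕ
      badness m xs = total (λ v → 𝟙 (Bad? m xs v)) xs

      Poor : Fin n → Set
      Poor v = Q * degree v < (a + 2) * n

      Poor? : ∀ v → Dec (Poor v)
      Poor? v = Q * degree v <? (a + 2) * n

      -- Fix a position and the vertex `v` in it. The other `m` entries are an independent sample,
      -- in which `v` has in-degree no larger than in the whole. A poor `v` gets the trivial bound
      -- 1, any other the bound of `chebyshev`.
      badness-moment : ∀ m → 0 < n → 0 < m →
        m * ∑ⱽ (suc m) (λ xs → badness m (Vec.toList xs)) ≤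
        suc m * (m * n ^ m * sum (λ v → 𝟙 (Poor? v)) + n * (Q * Q * n ^ m))
      badness-moment m 0<n 0<m = begin
        m * ∑ⱽ (suc m) (λ xs → badness m (Vec.toList xs))
          ≡⟨ cong (m *_) (trans (∑ⱽ-cong (suc m) λ xs → total-toList (λ v → 𝟙 (Bad? m (Vec.toList xs) v)) xs)
                                (∑ⱽ-sum (suc m) λ i xs → bad xs (Vec.lookup xs i))) ⟩
        m * sum (λ i → ∑ⱽ (suc m) λ xs → bad xs (Vec.lookup xs i))
          ≤⟨ *-monoʳ-≤ m (sum-≤-const position) ⟩
        m * (suc m * sum single)
          ≡⟨ trans (sym (*-assoc m (suc m) _)) (trans (cong (_* sum single) (*-comm m (suc m))) (*-assoc (suc m) m _)) ⟩
        suc m * (m * sum single)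
          ≤⟨ *-monoʳ-≤ (suc m) singles ⟩
        suc m * (m * N * p + n * (Q * Q * N)) ∎
        where
        open ≤-Reasoning
        N = n ^ m
        p = sum λ v → 𝟙 (Poor? v)
        bad : ∀ {l} → Vec (Fin n) l → Fin n → ℕ
        bad xs v = 𝟙 (Bad? m (Vec.toList xs) v)
        single : Fin n → ℕ
        single v = ∑ⱽ m λ xs → bad xs v

        position : ∀ i → ∑ⱽ (suc m) (λ xs → bad xs (Vec.lookup xs i)) ≤ sum single
        position i = ≤-trans (≤-reflexive (∑ⱽ-insertAt m (λ xs → bad xs (Vec.lookup xs i)) i))
          (sum-mono λ v → ∑ⱽ-mono m λ xs → ≤-trans
            (≤-reflexive (cong (bad (Vec.insertAt xs i v)) (Vecₚ.insertAt-lookup xs i v)))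
            (𝟙-mono (Bad? m (Vec.toList (Vec.insertAt xs i v)) v) (Bad? m (Vec.toList xs) v)
              λ b → ≤-<-trans (*-monoʳ-≤ Q (total-insertAt (λ u → 𝟙 (R? u v)) xs i v)) b))

        one : ∀ v → m * single v ≤ m * N * 𝟙 (Poor? v) + Q * Q * N
        one v = cases (Poor? v)
          where
          cases : (d : Dec (Poor v)) → m * single v ≤ m * N * 𝟙 d + Q * Q * N
          cases (yes _) = ≤-trans (*-monoʳ-≤ m (≤-trans (∑ⱽ-mono m λ xs → 𝟙≤1 (Bad? m (Vec.toList xs) v))
                                                        (≤-reflexive (∑ⱽ-const m 1))))
                            (≤-trans (≤-reflexive (sym (*-assoc m N 1))) (m≤m+n _ _))
          cases (no ¬poor) = ≤-trans (chebyshev (λ u → R? u v) a Q m 0<n 0<m (≮⇒≥ ¬poor)) (m≤n+m _ _)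

        singles : m * sum single ≤ m * N * p + n * (Q * Q * N)
        singles = begin
          m * sum single          ≡⟨ *-distribˡ-sum m single ⟩
          sum (λ v → m * single v) ≤⟨ sum-mono one ⟩
          sum (λ v → m * N * 𝟙 (Poor? v) + Q * Q * N)
            ≡⟨ ∑-distrib-+ (λ v → m * N * 𝟙 (Poor? v)) _ ⟩
          sum (λ v → m * N * 𝟙 (Poor? v)) + sum {n} (λ _ → Q * Q * N)
            ≡⟨ cong₂ _+_ (sym (*-distribˡ-sum (m * N) λ v → 𝟙 (Poor? v))) (sum-const n _) ⟩
          m * N * p + n * (Q * Q * N) ∎

    -- The vertices are the positions of the list, so that repetitions become distinct vertices not
    -- joined to each other.
    induced : (l : List (Fin n)) → Digraph (length l)
    induced l i j = does (R? (lookup l i) (lookup l j))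

    does-true : ∀ {u v} → does (R? u v) ≡ true → R u v
    does-true {u} {v} e with R? u v
    ... | yes r = r

    induced-oriented : ∀ l → IsOriented (induced l)
    induced-oriented l = (λ i → dec-false (R? _ _) λ r → asym r r)
                       , λ i j e → dec-false (R? _ _) (asym (does-true e))

    induced-inDegree : ∀ l j → inDegree (induced l) j ≡ degreeIn (lookup l j) l
    induced-inDegree l j = cong ListAction.sum (begin
      map (g ∘ lookup l) (tabulate id) ≡⟨ map-tabulate id (g ∘ lookup l) ⟩
      tabulate (g ∘ lookup l)          ≡⟨ sym (map-tabulate (lookup l) g) ⟩
      map g (tabulate (lookup l))      ≡⟨ cong (map g) (tabulate-lookup l) ⟩
      map g l                          ∎)
      where
      open ≡-Reasoning
      g : Fin n → ℕ
      g u = 𝟙 (R? u (lookup l j))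

    induced-triangle : ∀ l → HasDirectedTriangle (induced l) → 0 < totalTriples cyclic-orders l
    induced-triangle l (i , j , t , ij , jt , ti) = go i j t (does-true ij , does-true jt , does-true ti)
      where
      C : (i j t : Fin (length l)) → Set
      C i j t = Cyclic (lookup l i) (lookup l j) (lookup l t)
      same : ∀ {i j} → i ≡ j → ¬ R (lookup l i) (lookup l j)
      same refl r = asym r r
      first : ∀ i j t → i Fin.< j → i Fin.< t → C i j t → 0 < totalTriples cyclic-orders l
      first i j t i<j i<t c@(_ , r , _) with Finₚ.<-cmp j t
      ... | tri< j<t _ _ = ≤-trans (≤-trans (1≤𝟙 (Cyclic? _ _ _) c) (m≤m+n _ _)) (term≤totalTriples cyclic-orders l i<j j<t)
      ... | tri≈ _ e _   = contradiction r (same e)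
      ... | tri> _ _ t<j = ≤-trans (≤-trans (1≤𝟙 (Cyclic? _ _ _) c) (m≤n+m _ _)) (term≤totalTriples cyclic-orders l i<t t<j)
      go : ∀ i j t → C i j t → 0 < totalTriples cyclic-orders l
      go i j t (ij , jt , ti) with Finₚ.<-cmp i j | Finₚ.<-cmp j t | Finₚ.<-cmp t i
      ... | tri≈ _ e _ | _ | _ = contradiction ij (same e)
      ... | _ | tri≈ _ e _ | _ = contradiction jt (same e)
      ... | _ | _ | tri≈ _ e _ = contradiction ti (same e)
      ... | tri< i<j _ _ | _ | tri> _ _ i<t = first i j t i<j i<t (ij , jt , ti)
      ... | tri> _ _ j<i | tri< j<t _ _ | _ = first j t i j<t j<i (jt , ti , ij)
      ... | _ | tri> _ _ t<j | tri< t<i _ _ = first t i j t<i t<j (ti , ij , jt)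
      ... | tri< i<j _ _ | tri< j<t _ _ | tri< t<i _ _ =
        contradiction (Finₚ.<-trans i<j (Finₚ.<-trans j<t t<i)) (<-irrefl refl)
      ... | tri> _ _ j<i | tri> _ _ t<j | tri> _ _ i<t =
        contradiction (Finₚ.<-trans j<i (Finₚ.<-trans i<t t<j)) (<-irrefl refl)

    module _ (a Q : ℕ) (0<Q : 0 < Q)
             (sufficient : ∀ l → 0 < l → (A : Digraph l) → IsOriented A →
                           (∀ v → a * l ≤ Q * inDegree A v) → HasDirectedTriangle A)
             -- `p` will bound the number of poor vertices and τ n² that of cyclic triples. `K`
             -- exceeds the mean of `potential`, which is at most 1 + (2 Q² + 1). `m` is the
             -- solution of (a + 1) m = a (m + 1) + Q K.
             (p τ K m : ℕ) (K≡ : K ≡ 2 * (Q * Q) + 3) (m≡ : m ≡ a + Q * K) where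

      private
        0<K : 0 < K
        0<K = subst (0 <_) (sym K≡) (≤-trans (s≤s z≤n) (m≤n+m 3 _))
        QK≤m : Q * K ≤ m
        QK≤m = subst (Q * K ≤_) (sym m≡) (m≤n+m _ a)
        K≤QK : K ≤ Q * K
        K≤QK = m≤n*m K Q ⦃ >-nonZero 0<Q ⦄
        0<m : 0 < m
        0<m = ≤-trans (≤-trans 0<K K≤QK) QK≤m

        -- The weight `K` lets one average serve two purposes: a potential below `K` forces `tri` to
        -- vanish and `bads` to be below `K`.
        tri bads potential : Vec (Fin n) (suc m) → ℕ
        tri xs = totalTriples cyclic-orders (Vec.toList xs)
        bads xs = badness a Q m (Vec.toList xs)
        potential xs = K * tri xs + bads xs

      -- Fewer than `K` bad vertices are deleted. By the choice of `m`, the rest keep in-degree a /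
      -- Q times the size, so `sufficient` yields a directed triangle in a sample that has none.
      no-sample : (xs : Vec (Fin n) (suc m)) → ¬ (potential xs < K)
      no-sample xs potential<K = contradiction
        (induced-triangle l (sufficient (length l) l-nonempty (induced l) (induced-oriented l) rich))
        (≤⇒≯ (≤-trans (totalTriples-filter good? cyclic-orders ys) (≤-reflexive no-triples)))
        where
        open ≤-Reasoning
        ys : List (Fin n)
        ys = Vec.toList xs

        no-triples : tri xs ≡ 0
        no-triples = small-multiple (tri xs) (≤-<-trans (m≤m+n _ _) potential<K)

        bads<K : bads xs < K
        bads<K = ≤-<-trans (m≤n+m _ _) potential<K

        good? : ∀ v → Dec (¬ Bad a Q m ys v)
        good? v = ¬? (Bad? a Q m ys v)

        l : List (Fin n)
        l = filter good? ys

        removed : total (λ v → 𝟙 (¬? (good? v))) ys < K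
        removed = ≤-<-trans (total-mono ys λ v → 𝟙-mono (¬? (good? v)) (Bad? a Q m ys v)
          (decidable-stable (Bad? a Q m ys v))) bads<K

        loss : (g : Fin n → ℕ) → (∀ v → g v ≤ 1) → total g ys ≤ total g l + K
        loss g g≤1 = ≤-trans (filter-loss good? g g≤1 ys) (+-monoʳ-≤ (total g l) (<⇒≤ removed))

        length-ys : length ys ≡ suc m
        length-ys = Vecₚ.length-toList xs

        l-nonempty : 0 < length l
        l-nonempty = +-cancelʳ-< K 0 (length l) (begin-strict
          K                      <⟨ s≤s (≤-trans K≤QK QK≤m) ⟩
          (suc m)                      ≡⟨ trans (sym length-ys) (length≡total ys) ⟩
          total (λ _ → 1) ys     ≤⟨ loss (λ _ → 1) (λ _ → ≤-refl) ⟩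
          total (λ _ → 1) l + K  ≡⟨ cong (_+ K) (sym (length≡total l)) ⟩
          length l + K           ∎)

        rich : ∀ i → a * length l ≤ Q * inDegree (induced l) i
        rich i = subst (λ d → a * length l ≤ Q * d) (sym (induced-inDegree l i))
          (+-cancelʳ-≤ (Q * K) _ _ (begin
            a * length l + Q * K     ≤⟨ +-monoˡ-≤ (Q * K) (*-monoʳ-≤ a length-l) ⟩
            a * (suc m) + Q * K            ≡⟨ cong (λ s → a * suc s + Q * K) m≡ ⟩
            a * suc (a + Q * K) + Q * K ≡⟨ solve 2 (λ a k → a :* (con 1 :+ (a :+ k)) :+ k := (a :+ con 1) :* (a :+ k)) refl a (Q * K) ⟩
            (a + 1) * (a + Q * K)    ≡⟨ cong ((a + 1) *_) (sym m≡) ⟩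
            (a + 1) * m              ≤⟨ ≮⇒≥ (proj₂ (∈-filter⁻ good? {xs = ys} (∈-lookup i))) ⟩
            Q * degreeIn v ys        ≤⟨ *-monoʳ-≤ Q (loss (λ u → 𝟙 (R? u v)) (λ u → 𝟙≤1 (R? u v))) ⟩
            Q * (degreeIn v l + K)   ≡⟨ *-distribˡ-+ Q _ K ⟩
            Q * degreeIn v l + Q * K ∎))
          where
          v = lookup l i
          length-l : length l ≤ suc m
          length-l = ≤-trans (length-filter good? ys) (≤-reflexive length-ys)

      -- The first summand of the bound on `n` makes the mean of K · `tri` at most 1, its factor 2
      -- coming from the two cyclic orders; the second does the same for the number of poor vertices
      -- sampled.
      supersaturation : 2 * τ * K * (suc m * suc m * suc m) + suc m * p + 1 ≤ n →
        sum (λ v → 𝟙 (Poor? a Q v)) ≤ p →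
        sum (λ u → sum λ v → sum λ w → 𝟙 (Cyclic? u v w)) ≤ τ * (n * n) → ⊥
      supersaturation n≥ poor few = let xs , low = ∑ⱽ-witness M potential potential-sum in no-sample xs low
        where
        open ≤-Reasoning
        M = suc m
        N = n ^ m
        0<n : 0 < n
        0<n = ≤-trans (m≤n+m 1 _) n≥
        tri-sum : K * ∑ⱽ M tri ≤ n * N
        tri-sum = *-cancelʳ-≤ _ _ (n * n * n) ⦃ >-nonZero (*-mono-< (*-mono-< 0<n 0<n) 0<n) ⦄ (begin
          K * ∑ⱽ M tri * (n * n * n)
            ≡⟨ solve 3 (λ k t n → k :* t :* n := k :* (n :* t)) refl K (∑ⱽ M tri) (n * n * n) ⟩
          K * (n * n * n * ∑ⱽ M tri)
            ≤⟨ *-monoʳ-≤ K (triples-moment M cyclic-orders) ⟩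
          K * (M * M * M * (n * N * sum λ u → sum λ v → sum λ w → cyclic-orders u v w))
            ≤⟨ *-monoʳ-≤ K (*-monoʳ-≤ (M * M * M) (*-monoʳ-≤ (n * N) both)) ⟩
          K * (M * M * M * (n * N * (τ * (n * n) + τ * (n * n))))
            ≡⟨ solve 5 (λ k m n x t → k :* (m :* (n :* x :* (t :* (n :* n) :+ t :* (n :* n)))) :=
                  con 2 :* t :* k :* m :* (x :* (n :* n :* n))) refl K (M * M * M) n N τ ⟩
          2 * τ * K * (M * M * M) * (N * (n * n * n))
            ≤⟨ *-monoˡ-≤ (N * (n * n * n)) (≤-trans (≤-trans (m≤m+n (2 * τ * K * (M * M * M)) (M * p)) (m≤m+n _ 1)) n≥) ⟩
          n * (N * (n * n * n))
            ≡⟨ sym (*-assoc n N _) ⟩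
          n * N * (n * n * n) ∎)
          where
          both : sum (λ u → sum λ v → sum λ w → cyclic-orders u v w) ≤ τ * (n * n) + τ * (n * n)
          both = begin
            sum (λ u → sum λ v → sum λ w → cyclic-orders u v w)
              ≡⟨ trans (sum-cong-≗ λ u → sum₂-+ (λ v w → 𝟙 (Cyclic? u v w)) (λ v w → 𝟙 (Cyclic? u w v)))
                       (∑-distrib-+ (λ u → sum λ v → sum λ w → 𝟙 (Cyclic? u v w)) _) ⟩
            sum (λ u → sum λ v → sum λ w → 𝟙 (Cyclic? u v w)) + sum (λ u → sum λ v → sum λ w → 𝟙 (Cyclic? u w v))
              ≤⟨ +-mono-≤ few (≤-trans (≤-reflexive (sum-cong-≗ λ u → ∑-comm λ v w → 𝟙 (Cyclic? u w v))) few) ⟩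
            τ * (n * n) + τ * (n * n) ∎

        bads-sum : ∑ⱽ M bads ≤ (2 * (Q * Q) + 1) * (n * N)
        bads-sum = *-cancelˡ-≤ m ⦃ >-nonZero 0<m ⦄ (begin
          m * ∑ⱽ M bads
            ≤⟨ badness-moment a Q m 0<n 0<m ⟩
          M * (m * N * sum (λ v → 𝟙 (Poor? a Q v)) + n * (Q * Q * N))
            ≤⟨ *-monoʳ-≤ M (+-monoˡ-≤ _ (*-monoʳ-≤ (m * N) poor)) ⟩
          M * (m * N * p + n * (Q * Q * N))
            ≡⟨ solve 6 (λ s m x p n q → s :* (m :* x :* p :+ n :* (q :* q :* x)) :=
                  s :* p :* (m :* x) :+ s :* (q :* q :* (n :* x))) refl M m N p n Q ⟩
          M * p * (m * N) + M * (Q * Q * (n * N))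
            -- m + 1 ≤ 2 m bounds the Chebyshev part (m + 1) Q² / m by 2 Q².
            ≤⟨ +-mono-≤ (*-monoˡ-≤ (m * N) (≤-trans (≤-trans (m≤n+m (M * p) (2 * τ * K * (M * M * M))) (m≤m+n _ 1)) n≥))
                        (*-monoˡ-≤ (Q * Q * (n * N)) (+-monoˡ-≤ m {1} {m} 0<m)) ⟩
          n * (m * N) + (m + m) * (Q * Q * (n * N))
            ≡⟨ solve 4 (λ m n x q → n :* (m :* x) :+ (m :+ m) :* (q :* q :* (n :* x)) :=
                  m :* ((con 2 :* (q :* q) :+ con 1) :* (n :* x))) refl m n N Q ⟩
          m * ((2 * (Q * Q) + 1) * (n * N)) ∎)

        potential-sum : ∑ⱽ M potential < n ^ M * K
        potential-sum = begin-strict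
          ∑ⱽ M potential
            ≡⟨ trans (∑ⱽ-+ M (λ xs → K * tri xs) bads) (cong (_+ ∑ⱽ M bads) (∑ⱽ-* M K tri)) ⟩
          K * ∑ⱽ M tri + ∑ⱽ M bads
            ≤⟨ +-mono-≤ tri-sum bads-sum ⟩
          n * N + (2 * (Q * Q) + 1) * (n * N)
            <⟨ m<m+n _ (*-mono-< 0<n (m^n>0 n ⦃ >-nonZero 0<n ⦄ m)) ⟩
          n * N + (2 * (Q * Q) + 1) * (n * N) + n * N
            ≡⟨ trans (solve 2 (λ x q → x :+ (con 2 :* (q :* q) :+ con 1) :* x :+ x := x :* (con 2 :* (q :* q) :+ con 3)) refl (n * N) Q)
                     (cong (n * N *_) (sym K≡)) ⟩
          n ^ M * K ∎

  -- Ramsey numbers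

  module _ {n k : ℕ} where

    Colours : Set
    Colours = Fin n → Fin n → Fin n → Fin k

    MonoPath : Colours → (Fin 7 → Fin n) → Set
    MonoPath col f = Injective _≡_ _≡_ f ×
      (col (f (# 0)) (f (# 1)) (f (# 2)) ≡ col (f (# 2)) (f (# 3)) (f (# 4))) ×
      (col (f (# 2)) (f (# 3)) (f (# 4)) ≡ col (f (# 4)) (f (# 5)) (f (# 6)))

    MonoPath? : ∀ col f → Dec (MonoPath col f)
    MonoPath? col f = map′ (λ inj {x} {y} → inj x y) (λ inj x y → inj {x} {y})
        (all? λ x → all? λ y → (f x ≟ f y) →-dec (x ≟ y))
      ×-dec (_ ≟ _) ×-dec (_ ≟ _)

    -- Decoded functions agree with the original ones only pointwise.
    MonoPath-resp : ∀ {c d : Colours} {f g} → (∀ x y z → c x y z ≡ d x y z) → (∀ i → f i ≡ g i) →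
                    MonoPath c f → MonoPath d g
    MonoPath-resp {c} {d} {f} {g} c≡d f≡g (inj , e , e′) =
      (λ {x} {y} h → inj (trans (f≡g x) (trans h (sym (f≡g y)))))
      , trans (sym (same _ _ _)) (trans e (same _ _ _))
      , trans (sym (same _ _ _)) (trans e′ (same _ _ _))
      where
      same : ∀ i j l → c (f i) (f j) (f l) ≡ d (g i) (g j) (g l)
      same i j l rewrite f≡g i | f≡g j | f≡g l = c≡d _ _ _

    mono? : (col : Colours) → Dec (∃ (MonoPath col))
    mono? col = map′ (λ (c , p) → finToFun c , p)
      (λ (f , p) → funToFin f , MonoPath-resp {col} (λ _ _ _ → refl) (λ i → sym (finToFun-funToFin f i)) p)
      (any? λ c → MonoPath? col (finToFun c))

    decode : Fin (((k ^ n) ^ n) ^ n) → Colours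
    decode c x y z = finToFun (finToFun (finToFun c x) y) z

    encode : Colours → Fin (((k ^ n) ^ n) ^ n)
    encode col = funToFin λ x → funToFin λ y → funToFin λ z → col x y z

    decode-encode : ∀ col x y z → decode (encode col) x y z ≡ col x y z
    decode-encode col x y z = trans
      (cong (λ c → finToFun (finToFun c y) z) (finToFun-funToFin (λ x → funToFin λ y → funToFin (col x y)) x))
      (trans (cong (λ c → finToFun c z) (finToFun-funToFin (λ y → funToFin (col x y)) y))
             (finToFun-funToFin (col x y) z))

    Symmetric : Colours → Set
    Symmetric col = (∀ x y z → col x y z ≡ col y x z) × (∀ x y z → col x y z ≡ col x z y)

    Symmetric? : ∀ col → Dec (Symmetric col)
    Symmetric? col = (all? λ x → all? λ y → all? λ z → _ ≟ _) ×-dec (all? λ x → all? λ y → all? λ z → _ ≟ _)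

  -- Decidability lets the Ramsey number, a least element, be found constructively. Colour functions
  -- are enumerated by codes below k^(n³), and the symmetric ones are examined.
  Arrows? : ∀ n k → Dec (Arrows n k)
  Arrows? n k = map′ to from (all? λ c → Symmetric? (decode {n} {k} c) →-dec mono? (decode {n} {k} c))
    where
    to : (∀ c → Symmetric (decode {n} {k} c) → ∃ (MonoPath (decode {n} {k} c))) → Arrows n k
    to h χ = let f , p = h (encode col) symmetric in f , MonoPath-resp same (λ _ → refl) p
      where
      open Colouring3 χ
      same = decode-encode col
      symmetric : Symmetric (decode (encode col))
      symmetric = (λ x y z → trans (same x y z) (trans (sym₁₂ x y z) (sym (same y x z))))
                , (λ x y z → trans (same x y z) (trans (sym₂₃ x y z) (sym (same x z y))))
    from : Arrows n k → ∀ c → Symmetric (decode {n} {k} c) → ∃ (MonoPath (decode {n} {k} c))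
    from h c (s₁₂ , s₂₃) = h record { col = decode c ; sym₁₂ = s₁₂ ; sym₂₃ = s₂₃ }

  least : {P : ℕ → Set} → (∀ m → Dec (P m)) → ∀ N → P N → ∃ λ r → r ≤ N × P r × (∀ m → m < r → ¬ P m)
  least {P} P? = <-rec _ step
    where
    step : ∀ N → (∀ {M} → M < N → P M → ∃ λ r → r ≤ M × P r × (∀ m → m < r → ¬ P m)) →
           P N → ∃ λ r → r ≤ N × P r × (∀ m → m < r → ¬ P m)
    step N rec pN with anyUpTo? P? N
    ... | yes (M , M<N , pM) = let r , r≤M , rest = rec M<N pM in r , ≤-trans r≤M (<⇒≤ M<N) , rest
    ... | no none = N , ≤-refl , pN , λ m m<N pm → none (m , m<N , pm)

  -- From colourings to oriented graphs

  module _ (a Q : ℕ) (0<Q : 0 < Q)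
           (sufficient : ∀ l → 0 < l → (A : Digraph l) → IsOriented A →
                         (∀ v → a * l ≤ Q * inDegree A v) → HasDirectedTriangle A)
           where

    private
      -- τ is the constant of `Exc-count`. An apart pair lies in at least n / Q exceptional triples,
      -- and a poor vertex in at least n / Q apart pairs, whence `p`.
      τ p K m : ℕ
      τ = 240
      p = Q * Q * 240
      K = 2 * (Q * Q) + 3
      m = a + Q * K

    -- The last summand ensures Q ≤ n, which absorbs additive constants in `arrows`.
    threshold : ℕ
    threshold = 2 * τ * K * (suc m * suc m * suc m) + suc m * p + 1 + Q

    -- The gap says that n - k is at least (a + 4) n / Q. Of the 4, two go into the margin of
    -- `Poor`, one absorbs an additive `Q`, and the last leaves n / Q apart vertices at every poor
    -- vertex.
    arrows : ∀ n k → threshold ≤ n → Q * k + (a + 4) * n ≤ Q * n → Arrows n k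
    arrows n k n≥ gap χ with mono? (Colouring3.col χ)
    ... | yes mono = mono
    ... | no ¬mono = ⊥-elim (supersaturation a Q 0<Q sufficient p τ K m refl refl
            (≤-trans (m≤m+n _ Q) n≥) poor few)
      where
      open ColourClass χ ¬mono
      open Tournament Beats? (λ (_ , vu) (¬vu , _) → ¬vu vu)
      open ≤-Reasoning

      Q≤n : Q ≤ n
      Q≤n = ≤-trans (m≤n+m Q _) n≥
      0<n : 0 < n
      0<n = ≤-trans 0<Q Q≤n
      k≤n : k ≤ n
      k≤n = *-cancelˡ-≤ Q ⦃ >-nonZero 0<Q ⦄ (≤-trans (m≤m+n _ _) gap)

      Exc-total : sum (λ u → sum λ v → sum λ w → 𝟙 (Exc? u v w)) ≤ τ * (n * n)
      Exc-total = ≤-trans Exc-count (*-monoʳ-≤ τ (*-monoʳ-≤ n k≤n))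

      few : sum (λ u → sum λ v → sum λ w → 𝟙 (Cyclic? u v w)) ≤ τ * (n * n)
      few = ≤-trans (sum-mono λ u → sum-mono λ v → sum-mono λ w →
              𝟙-mono (Cyclic? u v w) (Exc? u v w) λ (uv , vw , wu) → beats-triangle uv vw wu) Exc-total

      slack : ∀ {x} → n ≤ k + x → (a + 4) * n ≤ Q * x
      slack {x} n≤ = +-cancelˡ-≤ (Q * k) _ _ (≤-trans gap (≤-trans (*-monoʳ-≤ Q n≤) (≤-reflexive (*-distribˡ-+ Q k x))))

      apart : Fin n → Fin n → ℕ
      apart u v = 𝟙 (Apart? u v)

      apart-exceptional : ∀ u v → n * apart u v ≤ Q * sum (λ w → 𝟙 (Exc? u v w))
      apart-exceptional u v = cases (Apart? u v)
        where
        e = sum (λ w → 𝟙 (Exc? u v w))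
        cases : (d : Dec (Apart u v)) → n * 𝟙 d ≤ Q * e
        cases (no _)  = ≤-trans (≤-reflexive (*-zeroʳ n)) z≤n
        cases (yes h) = +-cancelˡ-≤ (Q * 2) _ _ (begin
          Q * 2 + n * 1  ≤⟨ +-monoˡ-≤ (n * 1) (*-monoˡ-≤ 2 Q≤n) ⟩
          n * 2 + n * 1  ≤⟨ m≤m+n _ (n + a * n) ⟩
          n * 2 + n * 1 + (n + a * n) ≡⟨ solve 2 (λ n a → n :* con 2 :+ n :* con 1 :+ (n :+ a :* n) := (a :+ con 4) :* n) refl n a ⟩
          (a + 4) * n    ≤⟨ slack (≤-trans (apart-bound h) (≤-reflexive (+-assoc k 2 e))) ⟩
          Q * (2 + e)    ≡⟨ *-distribˡ-+ Q 2 e ⟩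
          Q * 2 + Q * e  ∎)

      apart-total : sum (λ u → sum (apart u)) ≤ Q * 240 * n
      apart-total = *-cancelˡ-≤ n ⦃ >-nonZero 0<n ⦄ (begin
        n * sum (λ u → sum (apart u))
          ≡⟨ trans (*-distribˡ-sum n λ u → sum (apart u)) (sum-cong-≗ λ u → *-distribˡ-sum n (apart u)) ⟩
        sum (λ u → sum λ v → n * apart u v)
          ≤⟨ sum-mono (λ u → sum-mono λ v → apart-exceptional u v) ⟩
        sum (λ u → sum λ v → Q * sum λ w → 𝟙 (Exc? u v w))
          ≡⟨ sym (trans (*-distribˡ-sum Q λ u → sum λ v → sum λ w → 𝟙 (Exc? u v w))
                        (sum-cong-≗ λ u → *-distribˡ-sum Q λ v → sum λ w → 𝟙 (Exc? u v w))) ⟩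
        Q * sum (λ u → sum λ v → sum λ w → 𝟙 (Exc? u v w))
          ≤⟨ *-monoʳ-≤ Q Exc-total ⟩
        Q * (τ * (n * n))
          ≡⟨ solve 3 (λ q t n → q :* (t :* (n :* n)) := n :* (q :* t :* n)) refl Q τ n ⟩
        n * (Q * τ * n) ∎)

      poor-apart : ∀ v → n * 𝟙 (Poor? a Q v) ≤ Q * sum (λ u → apart u v)
      poor-apart v = cases (Poor? a Q v)
        where
        c = sum (λ u → apart u v)
        cases : (d : Dec (Poor a Q v)) → n * 𝟙 d ≤ Q * c
        cases (no _)  = ≤-trans (≤-reflexive (*-zeroʳ n)) z≤n
        cases (yes h) = +-cancelˡ-≤ ((a + 2) * n + Q) _ _ (begin
          (a + 2) * n + Q + n * 1   ≤⟨ +-monoˡ-≤ (n * 1) (+-monoʳ-≤ ((a + 2) * n) Q≤n) ⟩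
          (a + 2) * n + n + n * 1   ≡⟨ solve 2 (λ n a → (a :+ con 2) :* n :+ n :+ n :* con 1 := (a :+ con 4) :* n) refl n a ⟩
          (a + 4) * n               ≤⟨ slack (≤-trans (degree-bound v) (≤-reflexive
                                         (trans (cong (_+ 1) (+-assoc k (degree v) c)) (+-assoc k _ 1)))) ⟩
          Q * (degree v + c + 1)    ≡⟨ solve 3 (λ q d c → q :* (d :+ c :+ con 1) := q :* d :+ q :+ q :* c) refl Q (degree v) c ⟩
          Q * degree v + Q + Q * c  ≤⟨ +-monoˡ-≤ (Q * c) (+-monoˡ-≤ Q (<⇒≤ h)) ⟩
          (a + 2) * n + Q + Q * c   ∎)

      poor : sum (λ v → 𝟙 (Poor? a Q v)) ≤ p
      poor = *-cancelˡ-≤ n ⦃ >-nonZero 0<n ⦄ (begin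
        n * sum (λ v → 𝟙 (Poor? a Q v))       ≡⟨ *-distribˡ-sum n (λ v → 𝟙 (Poor? a Q v)) ⟩
        sum (λ v → n * 𝟙 (Poor? a Q v))       ≤⟨ sum-mono poor-apart ⟩
        sum (λ v → Q * sum λ u → apart u v)   ≡⟨ sym (*-distribˡ-sum Q λ v → sum λ u → apart u v) ⟩
        Q * sum (λ v → sum λ u → apart u v)   ≡⟨ cong (Q *_) (∑-comm λ v u → apart u v) ⟩
        Q * sum (λ u → sum (apart u))         ≤⟨ *-monoʳ-≤ Q apart-total ⟩
        Q * (Q * 240 * n)                     ≡⟨ solve 3 (λ q t n → q :* (q :* t :* n) := n :* (q :* q :* t)) refl Q τ n ⟩
        n * (Q * Q * 240)                     ∎)

  -- Choice of the constants and passage to rationals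

  multiple-below : ∀ A X → 0 < A → 0 < X → ∃ λ n → n * A < X × X ≤ suc n * A
  -- Dividing X - 1 instead of X makes the first inequality strict.
  multiple-below A@(suc _) (suc x) _ _ = x / A
    , s≤s (≤-trans (m≤n+m _ (x % A)) (≤-reflexive (sym (m≡m%n+[m/n]*n x A))))
    , subst (_< suc (x / A) * A) (sym (m≡m%n+[m/n]*n x A)) (+-monoˡ-< (x / A * A) (m%n<n x A))

  import Data.Integer as ℤ
  import Data.Integer.Properties as ℤₚ
  import Data.Rational as ℚ
  import Data.Rational.Properties as ℚₚ
  import Data.Rational.Unnormalised as ℚᵘ
  import Data.Rational.Unnormalised.Properties as ℚᵘₚ
  open import Data.Integer using (+_; -[1+_])
  open import Data.Rational using (ℚ; mkℚ; 1ℚ; 0ℚ; *≤*; *<*; toℚᵘ)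
  open import Data.Rational.Unnormalised using (ℚᵘ; mkℚᵘ)

  toℚᵘ-⟦⟧ : ∀ n → toℚᵘ ⟦ n ⟧ ℚᵘ.≃ mkℚᵘ (+ n) 0
  toℚᵘ-⟦⟧ n = ℚₚ.toℚᵘ-fromℚᵘ (mkℚᵘ (+ n) 0)

  scaled-≤ : ∀ α l d → ℚ.↥ α ℤ.* + l ℤ.≤ + d ℤ.* ℚ.↧ α → α ℚ.* ⟦ l ⟧ ℚ.≤ ⟦ d ⟧
  scaled-≤ α@(mkℚ p q-1 _) l d h = ℚₚ.toℚᵘ-cancel-≤ (begin
    toℚᵘ (α ℚ.* ⟦ l ⟧)           ≃⟨ ℚₚ.toℚᵘ-homo-* α ⟦ l ⟧ ⟩
    toℚᵘ α ℚᵘ.* toℚᵘ ⟦ l ⟧       ≃⟨ ℚᵘₚ.*-congˡ {toℚᵘ α} (toℚᵘ-⟦⟧ l) ⟩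
    toℚᵘ α ℚᵘ.* mkℚᵘ (+ l) 0
      ≤⟨ ℚᵘ.*≤* (subst₂ ℤ._≤_ (sym (ℤₚ.*-identityʳ _))
           (cong (λ e → + d ℤ.* + e) (sym (*-identityʳ (suc q-1)))) h) ⟩
    mkℚᵘ (+ d) 0                 ≃⟨ ℚᵘₚ.≃-sym (toℚᵘ-⟦⟧ d) ⟩
    toℚᵘ ⟦ d ⟧                   ∎)
    where open ℚᵘₚ.≤-Reasoning

  -- If f is the denominator of ε, then ε ≥ 1 / f, as the numerator is at least 1. The last
  -- hypothesis is the claim for 1 / f in place of ε, with 1 - α written as s over the denominator
  -- of α.
  scaled-< : ∀ α ε r k s → ℚ.↧ α ≡ + s ℤ.+ ℚ.↥ α → ℤ.+ 0 ℤ.< ℚ.↥ ε →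
             r * s * ℚ.↧ₙ ε < k * ℚ.↧ₙ α * suc (ℚ.↧ₙ ε) →
             ⟦ r ⟧ ℚ.* (1ℚ ℚ.- α) ℚ.< (1ℚ ℚ.+ ε) ℚ.* ⟦ k ⟧
  scaled-< α@(mkℚ p q-1 _) ε@(mkℚ (+ suc e) f-1 _) r k s q≡ _ h = ℚₚ.toℚᵘ-cancel-< (begin-strict
    toℚᵘ (⟦ r ⟧ ℚ.* (1ℚ ℚ.- α))                       ≃⟨ ℚₚ.toℚᵘ-homo-* ⟦ r ⟧ (1ℚ ℚ.- α) ⟩
    toℚᵘ ⟦ r ⟧ ℚᵘ.* toℚᵘ (1ℚ ℚ.- α)
      ≃⟨ ℚᵘₚ.*-cong (toℚᵘ-⟦⟧ r)
           (ℚᵘₚ.≃-trans (ℚₚ.toℚᵘ-homo-+ 1ℚ (ℚ.- α)) (ℚᵘₚ.+-congʳ (toℚᵘ 1ℚ) (ℚₚ.toℚᵘ-homo‿- α))) ⟩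
    mkℚᵘ (+ r) 0 ℚᵘ.* (toℚᵘ 1ℚ ℚᵘ.+ ℚᵘ.- toℚᵘ α)      <⟨ ℚᵘ.*<* core ⟩
    (toℚᵘ 1ℚ ℚᵘ.+ toℚᵘ ε) ℚᵘ.* mkℚᵘ (+ k) 0           ≃⟨ ℚᵘₚ.≃-sym (ℚᵘₚ.*-cong (ℚₚ.toℚᵘ-homo-+ 1ℚ ε) (toℚᵘ-⟦⟧ k)) ⟩
    toℚᵘ (1ℚ ℚ.+ ε) ℚᵘ.* toℚᵘ ⟦ k ⟧                   ≃⟨ ℚᵘₚ.≃-sym (ℚₚ.toℚᵘ-homo-* (1ℚ ℚ.+ ε) ⟦ k ⟧) ⟩
    toℚᵘ ((1ℚ ℚ.+ ε) ℚ.* ⟦ k ⟧)                       ∎)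
    where
    open ℚᵘₚ.≤-Reasoning
    q f : ℕ
    q = suc q-1
    f = suc f-1
    lhs rhs : ℚᵘ
    lhs = mkℚᵘ (+ r) 0 ℚᵘ.* (toℚᵘ 1ℚ ℚᵘ.+ ℚᵘ.- toℚᵘ α)
    rhs = (toℚᵘ 1ℚ ℚᵘ.+ toℚᵘ ε) ℚᵘ.* mkℚᵘ (+ k) 0

    numerator : + 1 ℤ.* + q ℤ.+ ℤ.- p ℤ.* + 1 ≡ + s
    numerator = trans (cong₂ ℤ._+_ (trans (ℤₚ.*-identityˡ (+ q)) q≡) (ℤₚ.*-identityʳ (ℤ.- p)))
      (trans (ℤₚ.+-assoc (+ s) p (ℤ.- p)) (trans (cong (λ z → + s ℤ.+ z) (ℤₚ.+-inverseʳ p)) (ℤₚ.+-identityʳ (+ s))))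
    ↥lhs : ℚᵘ.↥ lhs ≡ + (r * s)
    ↥lhs = trans (cong (+ r ℤ.*_) numerator) (sym (ℤₚ.pos-* r s))
    ↥rhs : ℚᵘ.↥ rhs ≡ + ((f + suc e) * k)
    ↥rhs = trans (cong (ℤ._* + k) (cong₂ ℤ._+_ (ℤₚ.*-identityˡ (+ f)) (ℤₚ.*-identityʳ (+ suc e)))) (sym (ℤₚ.pos-* (f + suc e) k))
    ↧lhs : ℚᵘ.↧ lhs ≡ + q
    ↧lhs = cong +_ (trans (*-identityˡ (1 * q)) (*-identityˡ q))
    ↧rhs : ℚᵘ.↧ rhs ≡ + f
    ↧rhs = cong +_ (trans (*-identityʳ (1 * f)) (*-identityˡ f))

    core : ℚᵘ.↥ lhs ℤ.* ℚᵘ.↧ rhs ℤ.< ℚᵘ.↥ rhs ℤ.* ℚᵘ.↧ lhs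
    core = subst₂ ℤ._<_
      (sym (trans (cong₂ ℤ._*_ ↥lhs ↧rhs) (sym (ℤₚ.pos-* (r * s) f))))
      (sym (trans (cong₂ ℤ._*_ ↥rhs ↧lhs) (sym (ℤₚ.pos-* ((f + suc e) * k) q))))
      (ℤ.+<+ (<-≤-trans h (≤-trans (≤-reflexive (solve 3 (λ k q f → k :* q :* (con 1 :+ f) := (con 1 :+ f) :* k :* q) refl k q f))
        (*-monoˡ-≤ q (*-monoˡ-≤ k (≤-trans (≤-reflexive (+-comm 1 f)) (+-monoʳ-≤ f (s≤s z≤n))))))))
  scaled-< _ (mkℚ (+ 0) _ _) _ _ _ _ (ℤ.+<+ ()) _

  ramsey-bound : (α ε : ℚ) → DirectedTriangleSufficient α → 0ℚ ℚ.< ε →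
      ∃[ k₀ ] ((k : ℕ) → k ≥ k₀ →
      ∃[ r ] (IsRamseyNumberL k r × ⟦ r ⟧ ℚ.* (1ℚ ℚ.- α) ℚ.< (1ℚ ℚ.+ ε) ℚ.* ⟦ k ⟧))
  ramsey-bound (mkℚ -[1+ _ ] _ _) _ (*≤* () , _) _
  ramsey-bound α@(mkℚ (+ p) q-1 _) ε (_ , *<* 5p<2q , sufficient) (*<* 0<ε) = suc (N + s * f * t) , bound
    where
    open ≤-Reasoning
    q f s t a Q N : ℕ
    q = suc q-1
    f = ℚ.↧ₙ ε
    p<q : p < q
    p<q = *-cancelʳ-< 5 p q (<-≤-trans
      (ℤₚ.drop‿+<+ (subst₂ ℤ._<_ (sym (ℤₚ.pos-* p 5)) (sym (ℤₚ.pos-* 2 q)) 5p<2q))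
      (≤-trans (*-monoˡ-≤ q (m≤m+n 2 3)) (≤-reflexive (*-comm 5 q))))
    0<numerator : + 0 ℤ.< ℚ.↥ ε
    0<numerator = subst₂ ℤ._<_ (ℤₚ.*-zeroˡ (ℚ.↧ ε)) (ℤₚ.*-identityʳ (ℚ.↥ ε)) 0<ε
    s = q ∸ p
    -- Writing α as p t / (q t) makes room for the 4 of `arrows`: `gap` comes down to 4 (f + 1) n +
    -- s f t ≤ s t n, and since s f t ≤ n and s ≥ 1 this value of `t` suffices.
    t = (f + 1) * 4 + 1
    a = p * t
    Q = q * t

    q≡s+p : q ≡ s + p
    q≡s+p = sym (m∸n+n≡m (<⇒≤ p<q))
    0<s : 0 < s
    0<s = m<n⇒0<n∸m p<q
    0<t : 0 < t
    0<t = m≤n+m 1 ((f + 1) * 4)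
    0<Q : 0 < Q
    0<Q = *-mono-< (s≤s (z≤n {q-1})) 0<t

    sufficient′ : ∀ l → 0 < l → (A : Digraph l) → IsOriented A →
                  (∀ v → a * l ≤ Q * inDegree A v) → HasDirectedTriangle A
    sufficient′ l 0<l A oriented rich = sufficient l 0<l A oriented λ v →
      scaled-≤ α l (inDegree A v) (subst₂ ℤ._≤_ (ℤₚ.pos-* p l) (ℤₚ.pos-* (inDegree A v) q) (ℤ.+≤+
        (*-cancelˡ-≤ t ⦃ >-nonZero 0<t ⦄ (begin
          t * (p * l)              ≡⟨ solve 3 (λ t p l → t :* (p :* l) := p :* t :* l) refl t p l ⟩
          a * l                    ≤⟨ rich v ⟩
          Q * inDegree A v         ≡⟨ solve 3 (λ t q d → q :* t :* d := t :* (d :* q)) refl t q (inDegree A v) ⟩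
          t * (inDegree A v * q)   ∎))))

    N = threshold a Q 0<Q sufficient′

    bound : ∀ k → k ≥ suc (N + s * f * t) →
            ∃[ r ] (IsRamseyNumberL k r × ⟦ r ⟧ ℚ.* (1ℚ ℚ.- α) ℚ.< (1ℚ ℚ.+ ε) ℚ.* ⟦ k ⟧)
    bound k k≥ =
      -- The largest n below (1 + 1 / f) k / (1 - α).
      let n , n< , ≤n = multiple-below (s * f) (k * q * suc f) (*-mono-< 0<s 0<f)
                          (*-mono-< (*-mono-< (≤-trans (s≤s z≤n) k≥) (s≤s (z≤n {q-1}))) (s≤s (z≤n {f})))
          r , r≤n , ramsey = least (λ m → Arrows? m k) n (arrows a Q 0<Q sufficient′ n k
                               (≤-trans (m≤m+n N _) (large n ≤n)) (gap n ≤n))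
      in r , ramsey , scaled-< α ε r k s (cong +_ q≡s+p) 0<numerator
           (≤-<-trans (≤-trans (*-monoˡ-≤ f (*-monoˡ-≤ s r≤n)) (≤-reflexive (*-assoc n s f))) n<)
      where
      0<f : 0 < f
      0<f = s≤s z≤n
      -- As s ≤ q, the hypothesis gives k ≤ n + 1; the `suc` in the choice of k₀ makes up for this
      -- 1.
      large : ∀ n → k * q * suc f ≤ suc n * (s * f) → N + s * f * t ≤ n
      large n ≤n = ≤-pred (≤-trans k≥ (*-cancelʳ-≤ k (suc n) (q * suc f) (begin
        k * (q * suc f)      ≡⟨ sym (*-assoc k q (suc f)) ⟩
        k * q * suc f        ≤⟨ ≤n ⟩
        suc n * (s * f)      ≤⟨ *-monoʳ-≤ (suc n) (*-mono-≤ (m∸n≤m q p) (n≤1+n f)) ⟩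
        suc n * (q * suc f)  ∎)))
      gap : ∀ n → k * q * suc f ≤ suc n * (s * f) → Q * k + (a + 4) * n ≤ Q * n
      gap n ≤n = *-cancelˡ-≤ (suc f) (begin
        suc f * (q * t * k + (p * t + 4) * n)
          ≡⟨ solve 6 (λ f q t k p n → (con 1 :+ f) :* (q :* t :* k :+ (p :* t :+ con 4) :* n) :=
               t :* (k :* q :* (con 1 :+ f)) :+ (con 1 :+ f) :* (p :* t :* n) :+ (f :+ con 1) :* con 4 :* n) refl f q t k p n ⟩
        t * (k * q * suc f) + suc f * (p * t * n) + (f + 1) * 4 * n
          ≤⟨ +-monoˡ-≤ _ (+-monoˡ-≤ _ (*-monoʳ-≤ t ≤n)) ⟩
        t * (suc n * (s * f)) + suc f * (p * t * n) + (f + 1) * 4 * n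
          ≡⟨ solve 6 (λ f s t p n e → t :* ((con 1 :+ n) :* (s :* f)) :+ (con 1 :+ f) :* (p :* t :* n) :+ e :=
               s :* f :* t :+ (t :* n :* s :* f :+ (con 1 :+ f) :* (p :* t :* n) :+ e)) refl f s t p n ((f + 1) * 4 * n) ⟩
        s * f * t + (t * n * s * f + suc f * (p * t * n) + (f + 1) * 4 * n)
          ≤⟨ +-monoˡ-≤ _ (≤-trans (m≤n+m _ N) (large n ≤n)) ⟩
        n + (t * n * s * f + suc f * (p * t * n) + (f + 1) * 4 * n)
          ≡⟨ solve 3 (λ n x y → n :+ (x :+ y :* n) := x :+ (y :+ con 1) :* n) refl n (t * n * s * f + suc f * (p * t * n)) ((f + 1) * 4) ⟩
        t * n * s * f + suc f * (p * t * n) + t * n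
          ≤⟨ +-monoʳ-≤ (t * n * s * f + suc f * (p * t * n)) (m≤m*n (t * n) s ⦃ >-nonZero 0<s ⦄) ⟩
        t * n * s * f + suc f * (p * t * n) + t * n * s
          ≡⟨ solve 5 (λ f s t p n → t :* n :* s :* f :+ (con 1 :+ f) :* (p :* t :* n) :+ t :* n :* s :=
               (con 1 :+ f) :* ((s :+ p) :* t :* n)) refl f s t p n ⟩
        suc f * ((s + p) * t * n)
          ≡⟨ cong (λ z → suc f * (z * t * n)) (sym q≡s+p) ⟩
        suc f * (q * t * n) ∎)

open import Data.Nat using (ℕ; _≥_)
open import Data.Integer using (+_)
open import Data.Rational using (ℚ; _/_; 1ℚ; 0ℚ; _-_; _+_; _*_; _<_)
open import Data.Product using (Σ; _×_; ∃-syntax)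

theorem3 : (α ε : ℚ) → DirectedTriangleSufficient α → 0ℚ < ε →
    ∃[ k₀ ] ((k : ℕ) → k ≥ k₀ →
    ∃[ r ] (IsRamseyNumberL k r × ⟦ r ⟧ * (1ℚ - α) < (1ℚ + ε) * ⟦ k ⟧))
theorem3 = LoosePaths.ramsey-bound
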